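{- Let $\mathcal Q_{d,1}=\mathrm{conv}(A)\subseteq\mathbb R^d$ and $\mathcal Q_{d,2}=\mathrm{conv}(B)\subseteq\mathbb R^d$ be full-dimensional integral simplices, where the columns of $A,B\in\mathbb R^{d\times(d+1)}$ are the vertices. For an integer $n>d$, let $\mathcal Q^n_{d,1}=\mathrm{conv}(C)$ and $\mathcal Q^n_{d,2}=\mathrm{conv}(D)\subseteq\mathbb R^n$ where $$C=\begin{pmatrix}A&\mathbf 0_{d\times(n-d)}\\ \mathbf 0_{(n-d)\times(d+1)}&I_{n-d}\end{pmatrix},\qquad D=\begin{pmatrix}B&\mathbf 0_{d\times(n-d)}\\ \mathbf 0_{(n-d)\times(d+1)}&I_{n-d}\end{pmatrix}$$ (i.e. the $n$-dimensional pyramids obtained by embedding the simplices in $\mathbb R^n$ and adjoining the vertices $\mathbf e_{d+1},\dots,\mathbf e_n$). Then $\mathcal Q_{d,1}$ and $\mathcal Q_{d,2}$ are unimodularly equivalent if and only if $\mathcal Q^n_{d,1}$ and $\mathcal Q^n_{d,2}$ are unimodularly equivalent.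
   Context: Two polytopes $\mathcal P,\mathcal Q\subseteq\mathbb R^k$ are unimodularly equivalent if there are $U\in\mathrm{GL}_k(\mathbb Z)$ (integer matrices of determinant $\pm1$) and $\mathbf b\in\mathbb Z^k$ such that $\{U\mathbf x+\mathbf b:\mathbf x\in\mathcal P\}=\mathcal Q$.
   Formalization: The polytopes are taken in rational rather than real space: conv(·) consists of rational points with rational weights, affine independence is over the rationals, and unimodular equivalence is equality of these rational point sets; for integral simplices this agrees with the real notion. -}

module Defs where

open import Data.Nat as ℕ using (ℕ; zero; suc)
open import Data.Integer as ℤ using (ℤ; +_)
open import Data.Rational as ℚ using (ℚ; 0ℚ; 1ℚ)
open import Data.Fin using (Fin; zero; suc; splitAt; punchIn; toℕ)
open import Data.Fin.Properties using () renaming (_≟_ to _≟ᶠ_)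
open import Data.Sum using (_⊎_; inj₁; inj₂)
open import Data.Product using (Σ; _×_; _,_)
open import Relation.Binary.PropositionalEquality using (_≡_)
open import Relation.Nullary using (yes; no)
open import Function.Bundles using (_⇔_)

-- integer matrices with r rows and c columns (columns = points)
IntMat : ℕ → ℕ → Set
IntMat r c = Fin r → Fin c → ℤ

Point : ℕ → Set
Point k = Fin k → ℚ

ι : ℤ → ℚ
ι z = z ℚ./ 1

sumℤ : ∀ {n} → (Fin n → ℤ) → ℤ
sumℤ {zero}  f = + 0
sumℤ {suc n} f = f zero ℤ.+ sumℤ (λ i → f (suc i))

sumℚ : ∀ {n} → (Fin n → ℚ) → ℚ
sumℚ {zero}  f = 0ℚ
sumℚ {suc n} f = f zero ℚ.+ sumℚ (λ i → f (suc i))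

sign : ℕ → ℤ
sign zero = + 1
sign (suc k) = ℤ.- sign k

det : ∀ {n} → IntMat n n → ℤ
det {zero}  M = + 1
det {suc n} M = sumℤ (λ j → sign (toℕ j) ℤ.* (M zero j ℤ.* det (λ i k → M (suc i) (punchIn j k))))

IsUnimodular : ∀ {k} → IntMat k k → Set
IsUnimodular U = (det U ≡ + 1) ⊎ (det U ≡ ℤ.- (+ 1))

-- x ∈ conv(columns of V)   (rational points of the convex hull)
InConv : ∀ {k m} → IntMat k m → Point k → Set
InConv {k} {m} V x =
  Σ (Fin m → ℚ) λ w →
    ((j : Fin m) → 0ℚ ℚ.≤ w j) ×
    (sumℚ w ≡ 1ℚ) ×
    ((i : Fin k) → x i ≡ sumℚ (λ j → w j ℚ.* ι (V i j)))

AffinelyIndependent : ∀ {k m} → IntMat k m → Set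
AffinelyIndependent {k} {m} V =
  (μ : Fin m → ℚ) →
  sumℚ μ ≡ 0ℚ →
  ((i : Fin k) → sumℚ (λ j → μ j ℚ.* ι (V i j)) ≡ 0ℚ) →
  (j : Fin m) → μ j ≡ 0ℚ

FullDimSimplex : ∀ {d} → IntMat d (suc d) → Set
FullDimSimplex A = AffinelyIndependent A

affine : ∀ {k} → IntMat k k → (Fin k → ℤ) → Point k → Point k
affine U b x i = sumℚ (λ j → ι (U i j) ℚ.* x j) ℚ.+ ι (b i)

UnimodEquiv : ∀ {k m m'} → IntMat k m → IntMat k m' → Set
UnimodEquiv {k} V W =
  Σ (IntMat k k) λ U → Σ (Fin k → ℤ) λ b →
    IsUnimodular U ×
    ((y : Point k) →
      (Σ (Point k) λ x → InConv V x × ((i : Fin k) → y i ≡ affine U b x i)) ⇔ InConv W y)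

pyramid : ∀ {d} m → IntMat d (suc d) → IntMat (d ℕ.+ m) (suc d ℕ.+ m)
pyramid {d} m A i j with splitAt d i | splitAt (suc d) j
... | inj₁ i' | inj₁ j' = A i' j'
... | inj₂ i' | inj₂ j' with i' ≟ᶠ j'
...   | yes _ = + 1
...   | no  _ = + 0
pyramid m A i j | inj₁ _ | inj₂ _ = + 0
pyramid m A i j | inj₂ _ | inj₁ _ = + 0

{-# OPTIONS --safe #-}

-- An affine equivalence of simplices permutes the vertices, so it amounts to a pair of integral affine
-- maps that are mutually inverse on vertices. Such a pair extends to the pyramids. Conversely, peel off
-- one apex at a time: if F maps one pyramid to the other and t is the apex coordinate, then
--   x ↦ π (F (x, 0) + t (F (x, 0)) · F (apex)),   with π the projection to the base,
-- is integral affine and acts on base vertices as the first-return map of the vertex permutation of F;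
-- the same formula for the inverse permutation inverts it on vertices. Since d + 1 affinely independent
-- points span, maps inverse on vertices are inverse everywhere, and an integer matrix is invertible over
-- ℤ exactly when its determinant is ±1.
module Submission where

open import Defs
open import Algebra.Structures using (IsCommutativeRing)
open import Data.Bool using (if_then_else_)
open import Data.Fin using (Fin; zero; suc; _≟_; _↑ˡ_; _↑ʳ_; fromℕ<; join; punchIn; punchOut; splitAt; toℕ)
open import Data.Fin.Properties using (<⇒≢; any?; join-splitAt; pigeonhole; punchIn-injective; punchIn-punchOut; punchInᵢ≢i; punchOut-injective; splitAt-join; splitAt-↑ʳ; splitAt-↑ˡ; splitAt⁻¹-↑ʳ; splitAt⁻¹-↑ˡ; toℕ-fromℕ<; toℕ-injective; toℕ<n)
open import Data.Integer as ℤ using (ℤ; +_; -[1+_]; _+_; _*_; _-_; -_; ∣_∣)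
import Data.Integer.Properties as ℤₚ
open import Data.Integer.Tactic.RingSolver using (solve-∀)
open import Data.Maybe using (Maybe; just; nothing)
open import Data.Nat as ℕ using (ℕ; zero; suc; _≤_; s≤s)
import Data.Nat.Properties as ℕₚ
open import Data.Product using (Σ; ∃; ∃₂; _×_; _,_; proj₁; proj₂)
open import Data.Rational as ℚ using (ℚ; 0ℚ; 1ℚ)
import Data.Rational.Properties as ℚₚ
import Data.Rational.Unnormalised as ℚᵘ
import Data.Rational.Unnormalised.Properties as ℚᵘₚ
open import Data.Sum using (_⊎_; inj₁; inj₂)
open import Data.Vec.Functional using (insertAt)
open import Data.Vec.Functional.Properties using (insertAt-lookup; insertAt-punchIn)
open import Function using (_∘_; const)
open import Function.Bundles using (_⇔_; mk⇔; Equivalence)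
open import Relation.Binary using (tri<; tri≈; tri>)
open import Relation.Binary.PropositionalEquality
import Relation.Binary.Reasoning.Setoid as SetoidReasoning
open import Relation.Nullary using (yes; no; does; contradiction; ¬_; ¬?)
open import Relation.Nullary.Decidable using (dec-true; dec-false; decidable-stable)
open ≡-Reasoning

-- An equivalence of pyramids need not match apexes with apexes. For the triangle `0`, `e₁`, `e₂`
-- over the segment from `0` to `e₁`, exchanging the two coordinates is an equivalence whose base
-- block is the zero matrix, so cutting `U` down to its base block can destroy unimodularity. The
-- correction by the image of the apex repairs this: at a vertex the apex coordinate of the image is
-- 0 or 1, so it works as a switch, yet the formula stays affine because the image of the apex is a
-- constant vector. With a single apex there is at most one detour, so one correction suffices.
-- Following the determinant through this correction would be awkward. Equivalences are therefore
-- handled as pairs of maps, both corrected by the same formula, and the determinant is recovered at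
-- the end from the existence of an integral inverse. For that passage multiplicativity of `det` is
-- replaced by the uniqueness of alternating multilinear functions of the columns.

private variable
  m n c k : ℕ

-- Finite sums

-- `sumℤ` and `sumℚ` are separate functions, so a sum is axiomatised here by its two defining
-- equations, which hold by `refl` in both instances.
module FiniteSum
  {R : Set} {_⊕_ _⊗_ : R → R → R} { ⊖_ : R → R} {0# 1# : R}
  (isCommutativeRing : IsCommutativeRing _≡_ _⊕_ _⊗_ ⊖_ 0# 1#)
  (sum : {n : ℕ} → (Fin n → R) → R)
  (sum-[] : (f : Fin 0 → R) → sum f ≡ 0#)
  (sum-∷ : {n : ℕ} (f : Fin (suc n) → R) → sum f ≡ f zero ⊕ sum (f ∘ suc))
  where

  open IsCommutativeRing isCommutativeRing using (+-identityˡ; +-identityʳ; +-assoc; +-comm; distribˡ; zeroˡ; zeroʳ; *-assoc; *-comm; *-identityˡ)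

  sum-cong : {f g : Fin n → R} → f ≗ g → sum f ≡ sum g
  sum-cong {zero} {f} {g} _ = trans (sum-[] f) (sym (sum-[] g))
  sum-cong {suc n} {f} {g} eq = begin
    sum f                    ≡⟨ sum-∷ f ⟩
    f zero ⊕ sum (f ∘ suc)   ≡⟨ cong₂ _⊕_ (eq zero) (sum-cong (eq ∘ suc)) ⟩
    g zero ⊕ sum (g ∘ suc)   ≡⟨ sum-∷ g ⟨
    sum g                    ∎

  sum-zero : {f : Fin n → R} → (∀ i → f i ≡ 0#) → sum f ≡ 0#
  sum-zero {zero} {f} _ = sum-[] f
  sum-zero {suc n} {f} eq = begin
    sum f                   ≡⟨ sum-∷ f ⟩
    f zero ⊕ sum (f ∘ suc)  ≡⟨ cong₂ _⊕_ (eq zero) (sum-zero (eq ∘ suc)) ⟩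
    0# ⊕ 0#                 ≡⟨ +-identityˡ 0# ⟩
    0#                      ∎

  +-interchange : ∀ a b c d → (a ⊕ b) ⊕ (c ⊕ d) ≡ (a ⊕ c) ⊕ (b ⊕ d)
  +-interchange a b c d = begin
    (a ⊕ b) ⊕ (c ⊕ d)  ≡⟨ +-assoc a b (c ⊕ d) ⟩
    a ⊕ (b ⊕ (c ⊕ d))  ≡⟨ cong (a ⊕_) (+-assoc b c d) ⟨
    a ⊕ ((b ⊕ c) ⊕ d)  ≡⟨ cong (λ x → a ⊕ (x ⊕ d)) (+-comm b c) ⟩
    a ⊕ ((c ⊕ b) ⊕ d)  ≡⟨ cong (a ⊕_) (+-assoc c b d) ⟩
    a ⊕ (c ⊕ (b ⊕ d))  ≡⟨ +-assoc a c (b ⊕ d) ⟨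
    (a ⊕ c) ⊕ (b ⊕ d)  ∎

  sum-+ : (f g : Fin n → R) → sum (λ i → f i ⊕ g i) ≡ sum f ⊕ sum g
  sum-+ {zero} f g = begin
    sum (λ i → f i ⊕ g i)  ≡⟨ sum-[] _ ⟩
    0#                     ≡⟨ +-identityˡ 0# ⟨
    0# ⊕ 0#                ≡⟨ cong₂ _⊕_ (sum-[] f) (sum-[] g) ⟨
    sum f ⊕ sum g          ∎
  sum-+ {suc n} f g = begin
    sum (λ i → f i ⊕ g i)                                        ≡⟨ sum-∷ _ ⟩
    (f zero ⊕ g zero) ⊕ sum (λ i → f (suc i) ⊕ g (suc i))        ≡⟨ cong ((f zero ⊕ g zero) ⊕_) (sum-+ (f ∘ suc) (g ∘ suc)) ⟩
    (f zero ⊕ g zero) ⊕ (sum (f ∘ suc) ⊕ sum (g ∘ suc))          ≡⟨ +-interchange _ _ _ _ ⟩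
    (f zero ⊕ sum (f ∘ suc)) ⊕ (g zero ⊕ sum (g ∘ suc))          ≡⟨ cong₂ _⊕_ (sum-∷ f) (sum-∷ g) ⟨
    sum f ⊕ sum g                                                ∎

  sum-*ˡ : (c : R) (f : Fin n → R) → sum (λ i → c ⊗ f i) ≡ c ⊗ sum f
  sum-*ˡ {zero} c f = begin
    sum (λ i → c ⊗ f i)  ≡⟨ sum-[] _ ⟩
    0#                   ≡⟨ zeroʳ c ⟨
    c ⊗ 0#               ≡⟨ cong (c ⊗_) (sum-[] f) ⟨
    c ⊗ sum f            ∎
  sum-*ˡ {suc n} c f = begin
    sum (λ i → c ⊗ f i)                        ≡⟨ sum-∷ _ ⟩
    (c ⊗ f zero) ⊕ sum (λ i → c ⊗ f (suc i))   ≡⟨ cong ((c ⊗ f zero) ⊕_) (sum-*ˡ c (f ∘ suc)) ⟩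
    (c ⊗ f zero) ⊕ (c ⊗ sum (f ∘ suc))         ≡⟨ distribˡ c _ _ ⟨
    c ⊗ (f zero ⊕ sum (f ∘ suc))               ≡⟨ cong (c ⊗_) (sum-∷ f) ⟨
    c ⊗ sum f                                  ∎

  sum-*ʳ : (c : R) (f : Fin n → R) → sum (λ i → f i ⊗ c) ≡ sum f ⊗ c
  sum-*ʳ c f = begin
    sum (λ i → f i ⊗ c)  ≡⟨ sum-cong (λ i → *-comm (f i) c) ⟩
    sum (λ i → c ⊗ f i)  ≡⟨ sum-*ˡ c f ⟩
    c ⊗ sum f            ≡⟨ *-comm c (sum f) ⟩
    sum f ⊗ c            ∎

  sum-swap : (f : Fin m → Fin n → R) → sum (λ i → sum (f i)) ≡ sum (λ j → sum (λ i → f i j))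
  sum-swap {zero} f = trans (sum-[] _) (sym (sum-zero (λ j → sum-[] _)))
  sum-swap {suc m} f = begin
    sum (λ i → sum (f i))                                    ≡⟨ sum-∷ _ ⟩
    sum (f zero) ⊕ sum (λ i → sum (f (suc i)))               ≡⟨ cong (sum (f zero) ⊕_) (sum-swap (f ∘ suc)) ⟩
    sum (f zero) ⊕ sum (λ j → sum (λ i → f (suc i) j))       ≡⟨ sum-+ _ _ ⟨
    sum (λ j → f zero j ⊕ sum (λ i → f (suc i) j))           ≡⟨ sum-cong (λ j → sum-∷ _) ⟨
    sum (λ j → sum (λ i → f i j))                            ∎

  sum-single : {f : Fin n → R} (i : Fin n) → (∀ j → j ≢ i → f j ≡ 0#) → sum f ≡ f i
  sum-single {suc n} {f} zero off = begin
    sum f                   ≡⟨ sum-∷ f ⟩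
    f zero ⊕ sum (f ∘ suc)  ≡⟨ cong (f zero ⊕_) (sum-zero (λ j → off (suc j) (λ ()))) ⟩
    f zero ⊕ 0#             ≡⟨ +-identityʳ (f zero) ⟩
    f zero                  ∎
  sum-single {suc n} {f} (suc i) off = begin
    sum f                   ≡⟨ sum-∷ f ⟩
    f zero ⊕ sum (f ∘ suc)  ≡⟨ cong₂ _⊕_ (off zero (λ ())) (sum-single i (λ j j≢i → off (suc j) (λ { refl → j≢i refl }))) ⟩
    0# ⊕ f (suc i)          ≡⟨ +-identityˡ (f (suc i)) ⟩
    f (suc i)               ∎

  sum-assoc : (a : Fin m → R) (M : Fin m → Fin n → R) (x : Fin n → R) →
    sum (λ j → a j ⊗ sum (λ k → M j k ⊗ x k)) ≡ sum (λ k → sum (λ j → a j ⊗ M j k) ⊗ x k)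
  sum-assoc a M x = begin
    sum (λ j → a j ⊗ sum (λ k → M j k ⊗ x k))    ≡⟨ sum-cong (λ j → sum-*ˡ (a j) _) ⟨
    sum (λ j → sum (λ k → a j ⊗ (M j k ⊗ x k)))  ≡⟨ sum-cong (λ j → sum-cong (λ k → *-assoc (a j) (M j k) (x k))) ⟨
    sum (λ j → sum (λ k → (a j ⊗ M j k) ⊗ x k))  ≡⟨ sum-swap _ ⟩
    sum (λ k → sum (λ j → (a j ⊗ M j k) ⊗ x k))  ≡⟨ sum-cong (λ k → sum-*ʳ (x k) _) ⟩
    sum (λ k → sum (λ j → a j ⊗ M j k) ⊗ x k)    ∎

  sum-↑ˡ : ∀ n {f : Fin (n ℕ.+ m) → R} → (∀ j → f (n ↑ʳ j) ≡ 0#) → sum f ≡ sum (λ i → f (i ↑ˡ m))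
  sum-↑ˡ zero off = trans (sum-zero off) (sym (sum-[] _))
  sum-↑ˡ (suc n) {f} off = begin
    sum f                                      ≡⟨ sum-∷ f ⟩
    f zero ⊕ sum (f ∘ suc)                     ≡⟨ cong (f zero ⊕_) (sum-↑ˡ n off) ⟩
    f zero ⊕ sum (λ i → f (suc (i ↑ˡ _)))      ≡⟨ sum-∷ _ ⟨
    sum (λ i → f (i ↑ˡ _))                     ∎

  -- Branching on `does` lets `δ (suc i) (suc j)` reduce to `δ i j`; the expansion of the identity
  -- determinant and the peeling of an apex rely on this.
  δ : Fin n → Fin n → R
  δ i j = if does (i ≟ j) then 1# else 0#

  δ-diag : (i : Fin n) → δ i i ≡ 1#
  δ-diag i = cong (if_then 1# else 0#) (dec-true (i ≟ i) refl)

  δ-off : {i j : Fin n} → i ≢ j → δ i j ≡ 0#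
  δ-off {i = i} {j} i≢j = cong (if_then 1# else 0#) (dec-false (i ≟ j) i≢j)

  δ-sym : (i j : Fin n) → δ i j ≡ δ j i
  δ-sym i j with i ≟ j
  ... | yes refl = sym (δ-diag i)
  ... | no i≢j = sym (δ-off (i≢j ∘ sym))

  sum-δ : (i : Fin n) (f : Fin n → R) → sum (λ j → δ i j ⊗ f j) ≡ f i
  sum-δ i f = begin
    sum (λ j → δ i j ⊗ f j)  ≡⟨ sum-single i (λ j j≢i → trans (cong (_⊗ f j) (δ-off (j≢i ∘ sym))) (zeroˡ (f j))) ⟩
    δ i i ⊗ f i              ≡⟨ cong (_⊗ f i) (δ-diag i) ⟩
    1# ⊗ f i                 ≡⟨ *-identityˡ (f i) ⟩
    f i                      ∎

open FiniteSum ℤₚ.+-*-isCommutativeRing sumℤ (λ _ → refl) (λ _ → refl)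
  using (δ; δ-diag; δ-off; δ-sym)
  renaming (sum-cong to sumℤ-cong; sum-zero to sumℤ-zero; sum-+ to sumℤ-+; sum-*ˡ to sumℤ-*ˡ; sum-single to sumℤ-single; sum-assoc to sumℤ-assoc; sum-δ to sumℤ-δ)

open FiniteSum ℚₚ.+-*-isCommutativeRing sumℚ (λ _ → refl) (λ _ → refl)
  using ()
  renaming (δ to δℚ; δ-off to δℚ-off; sum-cong to sumℚ-cong; sum-zero to sumℚ-zero; sum-+ to sumℚ-+; sum-*ˡ to sumℚ-*ˡ; sum-*ʳ to sumℚ-*ʳ; sum-swap to sumℚ-swap; sum-single to sumℚ-single; sum-assoc to sumℚ-assoc; sum-δ to sumℚ-δ; sum-↑ˡ to sumℚ-↑ˡ)

-- Determinants

det-cong : {M N : IntMat n n} → (∀ i j → M i j ≡ N i j) → det M ≡ det N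
det-cong {zero} _ = refl
det-cong {suc n} eq = sumℤ-cong λ j →
  cong (sign (toℕ j) *_) (cong₂ _*_ (eq zero j) (det-cong λ i k → eq (suc i) (punchIn j k)))

-- In the expansion along the top row, column `j` enters term `j` through its top entry alone and
-- every other term through its minor alone, where the induction hypothesis applies.
det-linear : (j : Fin n) (c : ℤ) {M M₁ M₂ : IntMat n n} →
  (∀ i → M i j ≡ M₁ i j + c * M₂ i j) →
  (∀ i k → k ≢ j → M i k ≡ M₁ i k) →
  (∀ i k → k ≢ j → M i k ≡ M₂ i k) →
  det M ≡ det M₁ + c * det M₂
det-linear {suc n} j c {M} {M₁} {M₂} at-j off₁ off₂ = begin
  sumℤ (term M)                                ≡⟨ sumℤ-cong term-linear ⟩
  sumℤ (λ k → term M₁ k + c * term M₂ k)       ≡⟨ sumℤ-+ (term M₁) (λ k → c * term M₂ k) ⟩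
  det M₁ + sumℤ (λ k → c * term M₂ k)          ≡⟨ cong (_+_ (det M₁)) (sumℤ-*ˡ c (term M₂)) ⟩
  det M₁ + c * det M₂                          ∎
  where
  minor : IntMat (suc n) (suc n) → Fin (suc n) → IntMat n n
  minor X k i l = X (suc i) (punchIn k l)

  term : IntMat (suc n) (suc n) → Fin (suc n) → ℤ
  term X k = sign (toℕ k) * (X zero k * det (minor X k))

  entry-linear : ∀ s a b c D → s * ((a + c * b) * D) ≡ s * (a * D) + c * (s * (b * D))
  entry-linear = solve-∀

  minor-linear : ∀ s a D₁ D₂ c → s * (a * (D₁ + c * D₂)) ≡ s * (a * D₁) + c * (s * (a * D₂))
  minor-linear = solve-∀

  term-linear : ∀ k → term M k ≡ term M₁ k + c * term M₂ k
  term-linear k with k ≟ j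
  ... | yes refl = begin
    sign (toℕ k) * (M zero k * D)
      ≡⟨ cong (λ x → sign (toℕ k) * (x * D)) (at-j zero) ⟩
    sign (toℕ k) * ((M₁ zero k + c * M₂ zero k) * D)
      ≡⟨ entry-linear (sign (toℕ k)) (M₁ zero k) (M₂ zero k) c D ⟩
    sign (toℕ k) * (M₁ zero k * D) + c * (sign (toℕ k) * (M₂ zero k * D))
      ≡⟨ cong₂ (λ x y → sign (toℕ k) * (M₁ zero k * x) + c * (sign (toℕ k) * (M₂ zero k * y)))
           (det-cong (λ i l → off₁ (suc i) (punchIn k l) (punchInᵢ≢i k l)))
           (det-cong (λ i l → off₂ (suc i) (punchIn k l) (punchInᵢ≢i k l))) ⟩
    term M₁ k + c * term M₂ k ∎
    where D = det (minor M k)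
  ... | no k≢j = begin
    sign (toℕ k) * (M zero k * det (minor M k))
      ≡⟨ cong (λ x → sign (toℕ k) * (M zero k * x)) minors ⟩
    sign (toℕ k) * (M zero k * (D₁ + c * D₂))
      ≡⟨ minor-linear (sign (toℕ k)) (M zero k) D₁ D₂ c ⟩
    sign (toℕ k) * (M zero k * D₁) + c * (sign (toℕ k) * (M zero k * D₂))
      ≡⟨ cong₂ (λ x y → sign (toℕ k) * (x * D₁) + c * (sign (toℕ k) * (y * D₂)))
           (off₁ zero k k≢j) (off₂ zero k k≢j) ⟩
    term M₁ k + c * term M₂ k ∎
    where
    D₁ = det (minor M₁ k)
    D₂ = det (minor M₂ k)
    off : ∀ l → l ≢ punchOut k≢j → punchIn k l ≢ j
    off l l≢ eq = l≢ (punchIn-injective k l (punchOut k≢j) (trans eq (sym (punchIn-punchOut k≢j))))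
    minors : det (minor M k) ≡ D₁ + c * D₂
    minors = det-linear (punchOut k≢j) c
      (λ i → subst (λ p → M (suc i) p ≡ M₁ (suc i) p + c * M₂ (suc i) p) (sym (punchIn-punchOut k≢j)) (at-j (suc i)))
      (λ i l l≢ → off₁ (suc i) (punchIn k l) (off l l≢))
      (λ i l l≢ → off₂ (suc i) (punchIn k l) (off l l≢))

sumℤ-pair : {f : Fin n → ℤ} (i j : Fin n) → i ≢ j →
  (∀ k → k ≢ i → k ≢ j → f k ≡ + 0) → sumℤ f ≡ f i + f j
sumℤ-pair zero zero i≢j off = contradiction refl i≢j
sumℤ-pair {f = f} zero (suc j) i≢j off =
  cong (_+_ (f zero)) (sumℤ-single j λ k k≢j → off (suc k) (λ ()) λ { refl → k≢j refl })
sumℤ-pair {f = f} (suc i) zero i≢j off = trans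
  (cong (_+_ (f zero)) (sumℤ-single i λ k k≢i → off (suc k) (λ { refl → k≢i refl }) (λ ())))
  (ℤₚ.+-comm (f zero) (f (suc i)))
sumℤ-pair {f = f} (suc i) (suc j) i≢j off = trans
  (cong₂ _+_ (off zero (λ ()) (λ ()))
    (sumℤ-pair i j (i≢j ∘ cong suc) λ k k≢i k≢j → off (suc k) (λ { refl → k≢i refl }) λ { refl → k≢j refl }))
  (ℤₚ.+-identityˡ _)

-- No index lies strictly between `i` and `j`, so a deleted `k` lies on one side of both and shifts
-- both or neither.
punchOut-adjacent : {k i j : Fin (suc n)} (k≢i : k ≢ i) (k≢j : k ≢ j) →
  toℕ j ≡ suc (toℕ i) → toℕ (punchOut k≢j) ≡ suc (toℕ (punchOut k≢i))
punchOut-adjacent {k = zero} {zero} k≢i k≢j eq = contradiction refl k≢i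
punchOut-adjacent {k = zero} {suc i} {suc j} k≢i k≢j eq = ℕₚ.suc-injective eq
punchOut-adjacent {suc n} {suc zero} {zero} {suc zero} k≢i k≢j eq = contradiction refl k≢j
punchOut-adjacent {suc (suc n)} {suc (suc k)} {zero} {suc zero} k≢i k≢j eq = refl
punchOut-adjacent {suc n} {suc k} {suc i} {suc j} k≢i k≢j eq =
  cong suc (punchOut-adjacent (k≢i ∘ cong suc) (k≢j ∘ cong suc) (ℕₚ.suc-injective eq))

-- Deleting either of two neighbours leaves the same list of columns, except for one slot that holds
-- the surviving neighbour.
punchIn-adjacent : (i j : Fin (suc n)) → toℕ j ≡ suc (toℕ i) → (l : Fin n) →
  (punchIn i l ≡ punchIn j l) ⊎ (punchIn i l ≡ j × punchIn j l ≡ i)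
punchIn-adjacent zero (suc zero) eq zero = inj₂ (refl , refl)
punchIn-adjacent zero (suc zero) eq (suc l) = inj₁ refl
punchIn-adjacent (suc i) (suc j) eq zero = inj₁ refl
punchIn-adjacent (suc i) (suc j) eq (suc l) with punchIn-adjacent i j (ℕₚ.suc-injective eq) l
... | inj₁ same = inj₁ (cong suc same)
... | inj₂ (p , q) = inj₂ (cong suc p , cong suc q)

-- A minor that deletes neither column still has two equal neighbours and vanishes by induction. The
-- two remaining terms have equal entries and equal minors, and consecutive signs cancel them.
det-adjacent : (i j : Fin n) → toℕ j ≡ suc (toℕ i) → {M : IntMat n n} →
  (∀ k → M k i ≡ M k j) → det M ≡ + 0
det-adjacent {suc n} i j adj {M} eq = begin
  det M            ≡⟨ sumℤ-pair {f = term} i j i≢j other ⟩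
  term i + term j  ≡⟨ cong (_+_ (term i)) swapped ⟩
  term i + - term i  ≡⟨ ℤₚ.+-inverseʳ (term i) ⟩
  + 0              ∎
  where
  minor : Fin (suc n) → IntMat n n
  minor k r l = M (suc r) (punchIn k l)

  term : Fin (suc n) → ℤ
  term k = sign (toℕ k) * (M zero k * det (minor k))

  i≢j : i ≢ j
  i≢j refl = ℕₚ.1+n≢n (sym adj)

  vanish : ∀ s a → s * (a * + 0) ≡ + 0
  vanish = solve-∀

  negate : ∀ s a → - s * a ≡ - (s * a)
  negate = solve-∀

  other : ∀ k → k ≢ i → k ≢ j → term k ≡ + 0
  other k k≢i k≢j = trans
    (cong (λ x → sign (toℕ k) * (M zero k * x))
      (det-adjacent (punchOut k≢i) (punchOut k≢j) (punchOut-adjacent k≢i k≢j adj) λ r →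
        trans (cong (M (suc r)) (punchIn-punchOut k≢i))
          (trans (eq (suc r)) (cong (M (suc r)) (sym (punchIn-punchOut k≢j))))))
    (vanish (sign (toℕ k)) (M zero k))

  minors : ∀ r l → minor j r l ≡ minor i r l
  minors r l with punchIn-adjacent i j adj l
  ... | inj₁ same = cong (M (suc r)) (sym same)
  ... | inj₂ (p , q) = trans (cong (M (suc r)) q) (trans (eq (suc r)) (cong (M (suc r)) (sym p)))

  swapped : term j ≡ - term i
  swapped = begin
    sign (toℕ j) * (M zero j * det (minor j))    ≡⟨ cong₂ (λ s x → s * (x * det (minor j))) (cong sign adj) (sym (eq zero)) ⟩
    - sign (toℕ i) * (M zero i * det (minor j))  ≡⟨ cong (λ x → - sign (toℕ i) * (M zero i * x)) (det-cong minors) ⟩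
    - sign (toℕ i) * (M zero i * det (minor i))  ≡⟨ negate (sign (toℕ i)) _ ⟩
    - term i                                     ∎

-- Alternating multilinear functions of the columns

Family : ℕ → Set
Family n = Fin n → Fin n → ℤ

detᶜ : Family n → ℤ
detᶜ C = det (λ i j → C j i)

infixl 6 _[_≔_]
_[_≔_] : {A : Set} → (Fin n → A) → Fin n → A → Fin n → A
(C [ j ≔ v ]) k = if does (k ≟ j) then v else C k

≔-at : {A : Set} (C : Fin n → A) (j : Fin n) (v : A) → (C [ j ≔ v ]) j ≡ v
≔-at C j v = cong (if_then v else C j) (dec-true (j ≟ j) refl)

≔-off : {A : Set} (C : Fin n → A) {j k : Fin n} (v : A) → k ≢ j → (C [ j ≔ v ]) k ≡ C k
≔-off C {j} {k} v k≢j = cong (if_then v else C k) (dec-false (k ≟ j) k≢j)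

-- Alternation is only required for adjacent columns, where the two cofactors agree on the nose.
record IsAlternating (H : Family n → ℤ) : Set where
  field
    respects : {C D : Family n} → (∀ j → C j ≗ D j) → H C ≡ H D
    linear : (j : Fin n) (c : ℤ) {C C₁ C₂ : Family n} →
      (∀ i → C j i ≡ C₁ j i + c * C₂ j i) →
      (∀ k → k ≢ j → C k ≗ C₁ k) → (∀ k → k ≢ j → C k ≗ C₂ k) →
      H C ≡ H C₁ + c * H C₂
    adjacent : (i j : Fin n) → toℕ j ≡ suc (toℕ i) → {C : Family n} → C i ≗ C j → H C ≡ + 0

detᶜ-alternating : IsAlternating (detᶜ {n})
detᶜ-alternating = record
  { respects = λ eq → det-cong (λ i j → eq j i)
  ; linear = λ j c at off₁ off₂ → det-linear j c at (λ i k k≢j → off₁ k k≢j i) (λ i k k≢j → off₂ k k≢j i)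
  ; adjacent = λ i j adj eq → det-adjacent i j adj eq
  }

-- If `f` misses `p`, punching `p` out leaves one value fewer than arguments, and the pigeonhole
-- principle applies. It serves the sorting of basis columns and, later, the surjectivity of the
-- vertex correspondence.
hit-or-repeat : (f : Fin n → Fin n) (p : Fin n) →
  (∃ λ j → f j ≡ p) ⊎ (∃₂ λ i j → i ≢ j × f i ≡ f j)
hit-or-repeat {suc n} f p with any? (λ j → f j ≟ p)
... | yes hit = inj₁ hit
... | no miss with pigeonhole (ℕₚ.n<1+n n) (λ j → punchOut {i = p} (λ eq → miss (j , sym eq)))
...   | i , j , i<j , eq = inj₂ (i , j , <⇒≢ i<j , punchOut-injective {i = p} _ _ eq)

module Alternating {n : ℕ} {H : Family n → ℤ} (alt : IsAlternating H) where
  open IsAlternating alt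

  expand : (C : Family n) (j : Fin n) (c : Fin m → ℤ) (v : Fin m → Fin n → ℤ) →
    H (C [ j ≔ (λ i → sumℤ (λ k → c k * v k i)) ]) ≡ sumℤ (λ k → c k * H (C [ j ≔ v k ]))
  -- The empty sum puts the zero vector in column `j`. Since 0 = 0 + 1 · 0, linearity yields h = h +
  -- h.
  expand {zero} C j c v = h≡h+h⇒h≡0 (linear j (+ 1)
    (λ i → trans (cong (λ u → u i) (≔-at C j _)) (sym (cong₂ (λ u w → u i + (+ 1) * w i) (≔-at C j _) (≔-at C j _))))
    (λ k _ i → refl) (λ k _ i → refl))
    where
    cancel : ∀ h → (h + (+ 1) * h) - h ≡ h
    cancel = solve-∀
    h≡h+h⇒h≡0 : ∀ {h} → h ≡ h + (+ 1) * h → h ≡ + 0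
    h≡h+h⇒h≡0 {h} eq = trans (sym (cancel h)) (trans (cong (_- h) (sym eq)) (ℤₚ.+-inverseʳ h))
  expand {suc m} C j c v = begin
    H (C [ j ≔ whole ])
      ≡⟨ linear j (c zero)
           (λ i → trans (cong (λ u → u i) (≔-at C j whole))
             (trans (ℤₚ.+-comm (c zero * v zero i) (rest i))
               (sym (cong₂ (λ u w → u i + c zero * w i) (≔-at C j rest) (≔-at C j (v zero))))))
           (λ k k≢j i → cong (λ u → u i) (trans (≔-off C whole k≢j) (sym (≔-off C rest k≢j))))
           (λ k k≢j i → cong (λ u → u i) (trans (≔-off C whole k≢j) (sym (≔-off C (v zero) k≢j)))) ⟩
    H (C [ j ≔ rest ]) + c zero * H (C [ j ≔ v zero ])
      ≡⟨ ℤₚ.+-comm (H (C [ j ≔ rest ])) _ ⟩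
    c zero * H (C [ j ≔ v zero ]) + H (C [ j ≔ rest ])
      ≡⟨ cong (_+_ (c zero * H (C [ j ≔ v zero ]))) (expand C j (c ∘ suc) (v ∘ suc)) ⟩
    sumℤ (λ k → c k * H (C [ j ≔ v k ])) ∎
    where
    whole rest : Fin n → ℤ
    whole i = sumℤ (λ k → c k * v k i)
    rest i = sumℤ (λ k → c (suc k) * v (suc k) i)

  place : Family n → Fin n → Fin n → (Fin n → ℤ) → (Fin n → ℤ) → Family n
  place C i j u v = C [ j ≔ v ] [ i ≔ u ]

  VanishesOn : Fin n → Fin n → Set
  VanishesOn i j = {C : Family n} → C i ≗ C j → H C ≡ + 0

  module _ {i j : Fin n} (i≢j : i ≢ j) (C : Family n) where

    place-at₁ : ∀ u v → place C i j u v i ≡ u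
    place-at₁ u v = ≔-at (C [ j ≔ v ]) i u

    place-at₂ : ∀ u v → place C i j u v j ≡ v
    place-at₂ u v = trans (≔-off (C [ j ≔ v ]) u (i≢j ∘ sym)) (≔-at C j v)

    place-off : ∀ u v {k} → k ≢ i → k ≢ j → place C i j u v k ≡ C k
    place-off u v k≢i k≢j = trans (≔-off (C [ j ≔ v ]) u k≢i) (≔-off C v k≢j)

    place-self : ∀ k → place C i j (C i) (C j) k ≡ C k
    place-self k with k ≟ i
    ... | yes refl = refl
    ... | no k≢i with k ≟ j
    ...   | yes refl = refl
    ...   | no _ = refl

    place-indep₁ : ∀ u u′ v {k} → k ≢ i → place C i j u v k ≡ place C i j u′ v k
    place-indep₁ u u′ v k≢i = trans (≔-off (C [ j ≔ v ]) u k≢i) (sym (≔-off (C [ j ≔ v ]) u′ k≢i))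

    place-indep₂ : ∀ u v v′ {k} → k ≢ j → place C i j u v k ≡ place C i j u v′ k
    place-indep₂ u v v′ {k} k≢j with k ≟ i
    ... | yes _ = refl
    ... | no _ = trans (≔-off C v k≢j) (sym (≔-off C v′ k≢j))

    -- Polarisation: expand the value at `s = u + v` in both slots and drop the two diagonal terms.
    place-swap : VanishesOn i j → ∀ u v → H (place C i j u v) ≡ - H (place C i j v u)
    place-swap vanishes u v = solve-swap _ _ (begin
      (+ 0 + (+ 1) * K u v) + (+ 1) * (K v u + (+ 1) * + 0)
        ≡⟨ cong₂ (λ x y → (x + (+ 1) * K u v) + (+ 1) * (K v u + (+ 1) * y)) (sym (diag u)) (sym (diag v)) ⟩
      (K u u + (+ 1) * K u v) + (+ 1) * (K v u + (+ 1) * K v v)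
        ≡⟨ cong₂ (λ x y → x + (+ 1) * y) (sym (linear₂ u)) (sym (linear₂ v)) ⟩
      K u s + (+ 1) * K v s ≡⟨ sym linear₁ ⟩
      K s s ≡⟨ diag s ⟩
      + 0 ∎)
      where
      K : (Fin n → ℤ) → (Fin n → ℤ) → ℤ
      K u v = H (place C i j u v)
      s : Fin n → ℤ
      s k = u k + (+ 1) * v k
      diag : ∀ u → K u u ≡ + 0
      diag u = vanishes (λ k → cong (λ w → w k) (trans (place-at₁ u u) (sym (place-at₂ u u))))
      linear₁ : K s s ≡ K u s + (+ 1) * K v s
      linear₁ = linear i (+ 1)
        (λ k → trans (cong (λ w → w k) (place-at₁ s s))
          (sym (cong₂ (λ w x → w k + (+ 1) * x k) (place-at₁ u s) (place-at₁ v s))))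
        (λ k k≢i l → cong (λ w → w l) (place-indep₁ s u s k≢i))
        (λ k k≢i l → cong (λ w → w l) (place-indep₁ s v s k≢i))
      linear₂ : ∀ w → K w s ≡ K w u + (+ 1) * K w v
      linear₂ w = linear j (+ 1)
        (λ k → trans (cong (λ w → w k) (place-at₂ w s))
          (sym (cong₂ (λ w x → w k + (+ 1) * x k) (place-at₂ w u) (place-at₂ w v))))
        (λ k k≢i l → cong (λ w → w l) (place-indep₂ w s u k≢i))
        (λ k k≢i l → cong (λ w → w l) (place-indep₂ w s v k≢i))
      rearrange : ∀ a b → a ≡ ((+ 0 + (+ 1) * a) + (+ 1) * (b + (+ 1) * + 0)) - b
      rearrange = solve-∀
      solve-swap : ∀ a b → (+ 0 + (+ 1) * a) + (+ 1) * (b + (+ 1) * + 0) ≡ + 0 → a ≡ - b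
      solve-swap a b eq = trans (rearrange a b) (trans (cong (_- b) eq) (ℤₚ.+-identityˡ (- b)))

    swap : VanishesOn i j → H C ≡ - H (place C i j (C j) (C i))
    swap vanishes = trans (respects (λ k l → cong (λ w → w l) (sym (place-self k)))) (place-swap vanishes (C i) (C j))

  -- Induction on the distance: exchanging columns `j - 1` and `j` brings the repeated column one
  -- step closer to `i`, and the sign is harmless as the value sought is 0.
  vanishes-< : ∀ t (i j : Fin n) → toℕ j ≡ suc (t ℕ.+ toℕ i) → VanishesOn i j
  vanishes-< zero i j adj = adjacent i j adj
  vanishes-< (suc t) i j gap {C} eq = trans (swap j′≢j C (adjacent j′ j (trans gap (cong suc (sym toℕ-j′)))))
    (cong -_ (vanishes-< t i j′ toℕ-j′ λ l →
      trans (cong (λ w → w l) (place-off j′≢j C _ _ i≢j′ i≢j))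
        (trans (eq l) (cong (λ w → w l) (sym (place-at₁ j′≢j C _ _))))))
    where
    j′<n : suc (t ℕ.+ toℕ i) ℕ.< n
    j′<n = ℕₚ.<-trans (subst (suc (t ℕ.+ toℕ i) ℕ.<_) (sym gap) (ℕₚ.n<1+n _)) (toℕ<n j)
    j′ : Fin n
    j′ = fromℕ< j′<n
    toℕ-j′ : toℕ j′ ≡ suc (t ℕ.+ toℕ i)
    toℕ-j′ = toℕ-fromℕ< j′<n
    j′≢j : j′ ≢ j
    j′≢j eq′ = ℕₚ.1+n≢n (trans (sym gap) (trans (cong toℕ (sym eq′)) toℕ-j′))
    i≢j′ : i ≢ j′
    i≢j′ eq′ = ℕₚ.m≢1+n+m (toℕ i) (trans (cong toℕ eq′) toℕ-j′)
    i≢j : i ≢ j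
    i≢j eq′ = ℕₚ.m≢1+n+m (toℕ i) (trans (cong toℕ eq′) gap)

  gap : ∀ {a b} → a ℕ.< b → b ≡ suc ((b ℕ.∸ suc a) ℕ.+ a)
  gap {a} {b} a<b = trans (sym (ℕₚ.m∸n+n≡m a<b)) (ℕₚ.+-suc (b ℕ.∸ suc a) a)

  vanishes : {i j : Fin n} → i ≢ j → VanishesOn i j
  vanishes {i} {j} i≢j eq with ℕₚ.<-cmp (toℕ i) (toℕ j)
  ... | tri< i<j _ _ = vanishes-< _ i j (gap i<j) eq
  ... | tri≈ _ i≡j _ = contradiction (toℕ-injective i≡j) i≢j
  ... | tri> _ _ j<i = vanishes-< _ j i (gap j<i) (sym ∘ eq)

  module _ (H-δ : H δ ≡ + 0) where

    -- Selection sort: f is already the identity below k.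
    vanishes-on-basis : ∀ t k → k ℕ.+ t ≡ n → (f : Fin n → Fin n) →
      (∀ j → toℕ j ℕ.< k → f j ≡ j) → H (δ ∘ f) ≡ + 0
    vanishes-on-basis zero k k≡n f fixed = trans
      (respects (λ j i → cong (λ x → δ x i) (fixed j (subst (toℕ j ℕ.<_) (trans (sym k≡n) (ℕₚ.+-identityʳ k)) (toℕ<n j)))))
      H-δ
    vanishes-on-basis (suc t) k k+1+t≡n f fixed = by-cases (hit-or-repeat f p)
      where
      k<n : k ℕ.< n
      k<n = subst (k ℕ.<_) k+1+t≡n (ℕₚ.m<m+n k (s≤s ℕ.z≤n))
      p : Fin n
      p = fromℕ< k<n
      toℕ-p : toℕ p ≡ k
      toℕ-p = toℕ-fromℕ< k<n
      next : (g : Fin n → Fin n) → g p ≡ p → (∀ j → toℕ j ℕ.< k → g j ≡ j) → H (δ ∘ g) ≡ + 0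
      next g at-p below = vanishes-on-basis t (suc k) (trans (sym (ℕₚ.+-suc k t)) k+1+t≡n) g fixed′
        where
        fixed′ : ∀ j → toℕ j ℕ.< suc k → g j ≡ j
        fixed′ j j<1+k with j ≟ p
        ... | yes refl = at-p
        ... | no j≢p = below j (ℕₚ.≤∧≢⇒< (ℕₚ.≤-pred j<1+k) (λ eq → j≢p (toℕ-injective (trans eq (sym toℕ-p)))))
      by-cases : (∃ λ j → f j ≡ p) ⊎ (∃₂ λ i j → i ≢ j × f i ≡ f j) → H (δ ∘ f) ≡ + 0
      by-cases (inj₂ (i , j , i≢j , eq)) = vanishes i≢j (λ l → cong (λ x → δ x l) eq)
      by-cases (inj₁ (j , fj≡p)) with p ≟ j
      ... | yes refl = next f fj≡p fixed
      -- One transposition moves the value `p` into position `p`; its sign does not affect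
      -- vanishing.
      ... | no p≢j = trans (swap p≢j (δ ∘ f) (vanishes p≢j))
        (cong -_ (trans (respects relabel) (next g g-p g-below)))
        where
        g : Fin n → Fin n
        g = f [ j ≔ f p ] [ p ≔ f j ]
        g-p : g p ≡ p
        g-p = trans (≔-at (f [ j ≔ f p ]) p (f j)) fj≡p
        g-below : ∀ i → toℕ i ℕ.< k → g i ≡ i
        g-below i i<k = trans (≔-off (f [ j ≔ f p ]) (f j) i≢p) (trans (≔-off f (f p) i≢j) (fixed i i<k))
          where
          i≢p : i ≢ p
          i≢p refl = ℕₚ.<⇒≢ i<k toℕ-p
          -- Positions below `k` hold their own index, so the value `p` cannot be found there and
          -- the exchange leaves them alone.
          i≢j : i ≢ j
          i≢j refl = i≢p (trans (sym (fixed i i<k)) fj≡p)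
        relabel : ∀ i l → place (δ ∘ f) p j (δ (f j)) (δ (f p)) i l ≡ δ (g i) l
        relabel i l with i ≟ p
        ... | yes _ = refl
        ... | no _ with i ≟ j
        ...   | yes _ = refl
        ...   | no _ = refl

    -- `k` bounds the number of columns still arbitrary. Expanding the last of them in unit vectors
    -- lowers the bound, until every column is a basis vector.
    vanishes-beyond : ∀ k (C : Family n) → (∀ j → k ℕ.≤ toℕ j → ∃ λ i → C j ≗ δ i) → H C ≡ + 0
    vanishes-beyond zero C basis = trans (respects (λ j → proj₂ (basis j ℕ.z≤n)))
      (vanishes-on-basis n 0 refl (λ j → proj₁ (basis j ℕ.z≤n)) (λ j ()))
    vanishes-beyond (suc k) C basis with k ℕ.<? n
    ... | no k≮n = vanishes-beyond k C (λ j k≤j → contradiction (ℕₚ.≤-<-trans k≤j (toℕ<n j)) k≮n)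
    ... | yes k<n = begin
      H C
        ≡⟨ respects decompose ⟩
      H (C [ p ≔ (λ i → sumℤ (λ l → C p l * δ l i)) ])
        ≡⟨ expand C p (C p) δ ⟩
      sumℤ (λ l → C p l * H (C [ p ≔ δ l ]))
        ≡⟨ sumℤ-zero (λ l → trans (cong (C p l *_) (vanishes-beyond k (C [ p ≔ δ l ]) (basis′ l))) (ℤₚ.*-zeroʳ (C p l))) ⟩
      + 0 ∎
      where
      p : Fin n
      p = fromℕ< k<n
      δ-sum : ∀ i → C p i ≡ sumℤ (λ l → C p l * δ l i)
      δ-sum i = sym (trans (sumℤ-cong (λ l → trans (ℤₚ.*-comm (C p l) (δ l i)) (cong (_* C p l) (δ-sym l i)))) (sumℤ-δ i (C p)))
      decompose : ∀ j → C j ≗ (C [ p ≔ (λ i → sumℤ (λ l → C p l * δ l i)) ]) j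
      decompose j i with j ≟ p
      ... | yes refl = δ-sum i
      ... | no _ = refl
      basis′ : ∀ l j → k ℕ.≤ toℕ j → ∃ λ i → (C [ p ≔ δ l ]) j ≗ δ i
      basis′ l j k≤j with j ≟ p
      ... | yes refl = l , λ _ → refl
      ... | no j≢p = basis j (ℕₚ.≤∧≢⇒< k≤j (λ eq → j≢p (toℕ-injective (trans (sym eq) (sym (toℕ-fromℕ< k<n))))))

    vanishes-everywhere : (C : Family n) → H C ≡ + 0
    vanishes-everywhere C = vanishes-beyond n C (λ j n≤j → contradiction (toℕ<n j) (ℕₚ.≤⇒≯ n≤j))

detᶜ-δ : ∀ n → detᶜ {n} δ ≡ + 1
detᶜ-δ zero = refl
detᶜ-δ (suc n) = trans
  (sumℤ-single {n = suc n} {f = λ j → sign (toℕ j) * (δ j zero * det (λ i k → δ (punchIn j k) (suc i)))} zero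
    λ j j≢0 → trans (cong (λ x → sign (toℕ j) * (x * det (λ i k → δ (punchIn j k) (suc i)))) (δ-off j≢0)) (ℤₚ.*-zeroʳ (sign (toℕ j))))
  (cong (λ x → (+ 1) * ((+ 1) * x)) (detᶜ-δ n))

-- The difference of the two sides is again alternating and vanishes at the identity because
-- `detᶜ δ` is 1, so it vanishes everywhere.
alternating-unique : {G : Family n → ℤ} → IsAlternating G → (C : Family n) → G C ≡ G δ * detᶜ C
alternating-unique {n} {G} alt C = ℤₚ.i-j≡0⇒i≡j (G C) (G δ * detᶜ C) (Alternating.vanishes-everywhere difference at-δ C)
  where
  open IsAlternating
  g : ℤ
  g = G δ
  combine : ∀ a b c d e g → (a + c * b) - g * (d + c * e) ≡ (a - g * d) + c * (b - g * e)
  combine = solve-∀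
  difference : IsAlternating (λ C → G C - g * detᶜ C)
  difference = record
    { respects = λ eq → cong₂ (λ x y → x - g * y) (respects alt eq) (respects detᶜ-alternating eq)
    ; linear = λ j c {_} {C₁} {C₂} at off₁ off₂ → trans
        (cong₂ (λ x y → x - g * y) (linear alt j c at off₁ off₂) (linear detᶜ-alternating j c at off₁ off₂))
        (combine (G C₁) (G C₂) c (detᶜ C₁) (detᶜ C₂) g)
    ; adjacent = λ i j adj eq → trans
        (cong₂ (λ x y → x - g * y) (adjacent alt i j adj eq) (adjacent detᶜ-alternating i j adj eq))
        (cong (λ x → + 0 - x) (ℤₚ.*-zeroʳ g))
    }
  at-δ : G δ - g * detᶜ {n} δ ≡ + 0
  at-δ = trans (cong (λ x → g - g * x) (detᶜ-δ n)) (trans (cong (λ x → g - x) (ℤₚ.*-identityʳ g)) (ℤₚ.+-inverseʳ g))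

-- Integral inverses and determinant ±1

infix 4 _InverseOf_
_InverseOf_ : IntMat n n → IntMat n n → Set
N InverseOf M = ∀ i j → sumℤ (λ k → N i k * M k j) ≡ δ i j

-- Left multiplication by `N` acts on each column separately and linearly, so the determinant of the
-- product inherits all three properties from `det`.
det-*-alternating : (N : IntMat n n) → IsAlternating (λ C → det (λ i j → sumℤ (λ k → N i k * C j k)))
det-*-alternating N = record
  { respects = λ eq → det-cong (λ i j → sumℤ-cong (λ k → cong (N i k *_) (eq j k)))
  ; linear = λ j c {C} {C₁} {C₂} at off₁ off₂ → det-linear j c
      (λ i → begin
        sumℤ (λ k → N i k * C j k)
          ≡⟨ sumℤ-cong (λ k → trans (cong (N i k *_) (at k)) (spread (N i k) (C₁ j k) c (C₂ j k))) ⟩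
        sumℤ (λ k → N i k * C₁ j k + c * (N i k * C₂ j k))
          ≡⟨ sumℤ-+ (λ k → N i k * C₁ j k) (λ k → c * (N i k * C₂ j k)) ⟩
        sumℤ (λ k → N i k * C₁ j k) + sumℤ (λ k → c * (N i k * C₂ j k))
          ≡⟨ cong (_+_ (sumℤ (λ k → N i k * C₁ j k))) (sumℤ-*ˡ c (λ k → N i k * C₂ j k)) ⟩
        sumℤ (λ k → N i k * C₁ j k) + c * sumℤ (λ k → N i k * C₂ j k) ∎)
      (λ i l l≢j → sumℤ-cong (λ k → cong (N i k *_) (off₁ l l≢j k)))
      (λ i l l≢j → sumℤ-cong (λ k → cong (N i k *_) (off₂ l l≢j k)))
  ; adjacent = λ i j adj eq → det-adjacent i j adj (λ l → sumℤ-cong (λ k → cong (N l k *_) (eq k)))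
  }
  where
  spread : ∀ a b c d → a * (b + c * d) ≡ a * b + c * (a * d)
  spread = solve-∀

∣i∣≡1⇒i≡±1 : ∀ i → ∣ i ∣ ≡ 1 → (i ≡ + 1) ⊎ (i ≡ - + 1)
∣i∣≡1⇒i≡±1 (+ 1) refl = inj₁ refl
∣i∣≡1⇒i≡±1 -[1+ 0 ] refl = inj₂ refl

-- By uniqueness, C ↦ det (N C) is a constant integer `x` times the determinant. At `C = M` this
-- reads `x * det M = 1`, which makes `det M` a unit of ℤ.
invertible⇒unimodular : {N M : IntMat n n} → N InverseOf M → IsUnimodular M
invertible⇒unimodular {n} {N} {M} NM≡1 = ∣i∣≡1⇒i≡±1 (det M)
  (ℕₚ.m*n≡1⇒n≡1 ∣ x ∣ ∣ det M ∣ (trans (sym (ℤₚ.abs-* x (det M))) (cong ∣_∣ product)))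
  where
  G : Family n → ℤ
  G C = det (λ i j → sumℤ (λ k → N i k * C j k))
  x : ℤ
  x = G δ
  product : x * det M ≡ + 1
  product = begin
    x * det M              ≡⟨ alternating-unique (det-*-alternating N) (λ j i → M i j) ⟨
    G (λ j i → M i j)      ≡⟨ det-cong (λ i j → trans (NM≡1 i j) (δ-sym i j)) ⟩
    detᶜ {n} δ             ≡⟨ detᶜ-δ n ⟩
    + 1                    ∎

-- Cramer's rule: replacing column i by the unit vectors gives row i of the adjugate.
unimodular⇒invertible : {U : IntMat n n} → IsUnimodular U → ∃ λ N → N InverseOf U
unimodular⇒invertible {n} {U} unimodular = (λ i k → ε * adj i k) , λ i j → begin
  sumℤ (λ k → (ε * adj i k) * U k j)
    ≡⟨ sumℤ-cong (λ k → rotate ε (adj i k) (U k j)) ⟩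
  sumℤ (λ k → ε * (U k j * adj i k))
    ≡⟨ sumℤ-*ˡ ε (λ k → U k j * adj i k) ⟩
  ε * sumℤ (λ k → U k j * adj i k)
    ≡⟨ cong (ε *_) (expand C i (C j) δ) ⟨
  ε * detᶜ (C [ i ≔ (λ l → sumℤ (λ k → C j k * δ k l)) ])
    ≡⟨ cong (ε *_) (replaced i j) ⟩
  ε * (ε * δ i j)
    ≡⟨ ℤₚ.*-assoc ε ε (δ i j) ⟨
  ε * ε * δ i j
    ≡⟨ cong (_* δ i j) (ε²≡1 unimodular) ⟩
  (+ 1) * δ i j
    ≡⟨ ℤₚ.*-identityˡ (δ i j) ⟩
  δ i j ∎
  where
  open Alternating (detᶜ-alternating {n})
  ε : ℤ
  ε = det U
  C : Family n
  C j i = U i j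
  adj : IntMat n n
  adj i k = detᶜ (C [ i ≔ δ k ])
  rotate : ∀ e a u → (e * a) * u ≡ e * (u * a)
  rotate = solve-∀
  ε²≡1 : IsUnimodular U → ε * ε ≡ + 1
  ε²≡1 (inj₁ eq) = cong (λ x → x * x) eq
  ε²≡1 (inj₂ eq) = cong (λ x → x * x) eq
  column : ∀ j l → sumℤ (λ k → C j k * δ k l) ≡ C j l
  column j l = trans (sumℤ-cong (λ k → trans (ℤₚ.*-comm (C j k) (δ k l)) (cong (_* C j k) (δ-sym k l)))) (sumℤ-δ l (C j))
  -- Putting column `j` in place of column `i` restores the matrix if `i = j` and repeats a column
  -- otherwise. The remaining factor `ε` is cancelled by a second one, as ±1 is its own inverse.
  replaced : ∀ i j → detᶜ (C [ i ≔ (λ l → sumℤ (λ k → C j k * δ k l)) ]) ≡ ε * δ i j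
  replaced i j with i ≟ j
  ... | yes refl = trans (det-cong restore) (sym (ℤₚ.*-identityʳ ε))
    where
    restore : ∀ l k → (C [ i ≔ (λ l → sumℤ (λ k → C i k * δ k l)) ]) k l ≡ U l k
    restore l k with k ≟ i
    ... | yes refl = column i l
    ... | no _ = refl
  ... | no i≢j = trans
    (vanishes i≢j (λ l → trans (cong (λ w → w l) (≔-at C i _))
      (trans (column j l) (cong (λ w → w l) (sym (≔-off C _ (i≢j ∘ sym)))))))
    (sym (ℤₚ.*-zeroʳ ε))

-- The embedding of ℤ in ℚ

-- `z / 1` is put in lowest terms, which blocks direct computation with `ι`. Identities are
-- therefore checked on the unnormalised fraction, where the 0 encodes denominator 1.
toℚᵘ-ι : ∀ z → ℚ.toℚᵘ (ι z) ℚᵘ.≃ ℚᵘ.mkℚᵘ z 0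
toℚᵘ-ι z = ℚₚ.toℚᵘ-fromℚᵘ (ℚᵘ.mkℚᵘ z 0)

ι-injective : ∀ {a b} → ι a ≡ ι b → a ≡ b
ι-injective {a} {b} eq with ℚᵘₚ.≃-trans (ℚᵘₚ.≃-sym (toℚᵘ-ι a)) (ℚᵘₚ.≃-trans (ℚₚ.toℚᵘ-cong eq) (toℚᵘ-ι b))
... | ℚᵘ.*≡* a*1≡b*1 = trans (sym (ℤₚ.*-identityʳ a)) (trans a*1≡b*1 (ℤₚ.*-identityʳ b))

ι-+ : ∀ a b → ι (a + b) ≡ ι a ℚ.+ ι b
ι-+ a b = ℚₚ.toℚᵘ-injective (begin′
  ℚ.toℚᵘ (ι (a + b))                    ≈⟨ toℚᵘ-ι (a + b) ⟩
  ℚᵘ.mkℚᵘ (a + b) 0                     ≈⟨ ℚᵘ.*≡* (cong (_* + 1) (sym (cong₂ _+_ (ℤₚ.*-identityʳ a) (ℤₚ.*-identityʳ b)))) ⟩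
  ℚᵘ.mkℚᵘ a 0 ℚᵘ.+ ℚᵘ.mkℚᵘ b 0          ≈⟨ ℚᵘₚ.+-cong (toℚᵘ-ι a) (toℚᵘ-ι b) ⟨
  ℚ.toℚᵘ (ι a) ℚᵘ.+ ℚ.toℚᵘ (ι b)        ≈⟨ ℚₚ.toℚᵘ-homo-+ (ι a) (ι b) ⟨
  ℚ.toℚᵘ (ι a ℚ.+ ι b)                  ∎′)
  where open SetoidReasoning ℚᵘₚ.≃-setoid renaming (begin_ to begin′_; _∎ to _∎′)

ι-* : ∀ a b → ι (a * b) ≡ ι a ℚ.* ι b
ι-* a b = ℚₚ.toℚᵘ-injective (begin′
  ℚ.toℚᵘ (ι (a * b))                    ≈⟨ toℚᵘ-ι (a * b) ⟩
  ℚᵘ.mkℚᵘ (a * b) 0                     ≈⟨ ℚᵘ.*≡* refl ⟩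
  ℚᵘ.mkℚᵘ a 0 ℚᵘ.* ℚᵘ.mkℚᵘ b 0          ≈⟨ ℚᵘₚ.*-cong (toℚᵘ-ι a) (toℚᵘ-ι b) ⟨
  ℚ.toℚᵘ (ι a) ℚᵘ.* ℚ.toℚᵘ (ι b)        ≈⟨ ℚₚ.toℚᵘ-homo-* (ι a) (ι b) ⟨
  ℚ.toℚᵘ (ι a ℚ.* ι b)                  ∎′)
  where open SetoidReasoning ℚᵘₚ.≃-setoid renaming (begin_ to begin′_; _∎ to _∎′)

ι-sum : (f : Fin n → ℤ) → ι (sumℤ f) ≡ sumℚ (ι ∘ f)
ι-sum {zero} f = refl
ι-sum {suc n} f = trans (ι-+ (f zero) _) (cong (ι (f zero) ℚ.+_) (ι-sum (f ∘ suc)))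

-- Affine functions on a full-dimensional simplex

sumℤ-remove : (j : Fin (suc n)) (f : Fin (suc n) → ℤ) → sumℤ f ≡ f j + sumℤ (f ∘ punchIn j)
sumℤ-remove zero f = refl
sumℤ-remove {suc n} (suc j) f = trans (cong (_+_ (f zero)) (sumℤ-remove j (f ∘ suc))) (exchange (f zero) (f (suc j)) _)
  where
  exchange : ∀ a b c → a + (b + c) ≡ b + (a + c)
  exchange = solve-∀

NonzeroKernel : IntMat m n → Set
NonzeroKernel {m} {n} M =
  Σ (Fin n → ℤ) λ x → (∃ λ j → x j ≢ + 0) × (∀ i → sumℤ (λ j → M i j * x j) ≡ + 0)

-- Fraction-free Gaussian elimination, which keeps the solution integral.
kernel-vector : (M : IntMat n (suc n)) → NonzeroKernel M
kernel-vector {zero} M = const (+ 1) , (zero , λ ()) , λ ()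
kernel-vector {suc n} M with any? (λ j → ¬? (M zero j ℤ.≟ + 0))
-- The top equation is void. Discarding column `zero` along with it, by setting that unknown to 0,
-- keeps one more unknown than equations.
... | no zero-row with kernel-vector (λ i j → M (suc i) (suc j))
...   | y , (j , yj≢0) , My≡0 = x , (suc j , yj≢0) , Mx≡0
  where
  x : Fin (suc (suc n)) → ℤ
  x zero = + 0
  x (suc k) = y k
  Mx≡0 : ∀ i → sumℤ (λ j → M i j * x j) ≡ + 0
  Mx≡0 zero = sumℤ-zero (λ j → cong (_* x j) (decidable-stable (M zero j ℤ.≟ + 0) (λ nz → zero-row (j , nz))))
  Mx≡0 (suc i) = cong₂ _+_ (ℤₚ.*-zeroʳ (M (suc i) zero)) (My≡0 i)
kernel-vector {suc n} M | yes (p , a≢0)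
  -- Each lower row is multiplied by the pivot `M zero p`, and the multiple of the top row that
  -- clears column `p` is subtracted.
  with kernel-vector (λ i k → M zero p * M (suc i) (punchIn p k) - M (suc i) p * M zero (punchIn p k))
... | y , (j , yj≢0) , My≡0 = x , (punchIn p j , xj≢0) , Mx≡0
  where
  a s : ℤ
  a = M zero p
  s = sumℤ (λ k → M zero (punchIn p k) * y k)
  x : Fin (suc (suc n)) → ℤ
  -- Back substitution would give the unknown at `p` as `- s / a`; scaling the whole solution by the
  -- pivot `a` avoids the division, and it stays nonzero because `a` is.
  x = insertAt (λ k → a * y k) p (- s)
  xj≢0 : x (punchIn p j) ≢ + 0
  xj≢0 eq with ℤₚ.i*j≡0⇒i≡0∨j≡0 a (trans (sym (insertAt-punchIn (λ k → a * y k) p (- s) j)) eq)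
  ... | inj₁ a≡0 = a≢0 a≡0
  ... | inj₂ yj≡0 = yj≢0 yj≡0
  commute : ∀ a b c → a * (b * c) ≡ b * (a * c)
  commute = solve-∀
  row : ∀ i → sumℤ (λ j → M i j * x j) ≡ M i p * - s + a * sumℤ (λ k → M i (punchIn p k) * y k)
  row i = begin
    sumℤ (λ j → M i j * x j)
      ≡⟨ sumℤ-remove p (λ j → M i j * x j) ⟩
    M i p * x p + sumℤ (λ k → M i (punchIn p k) * x (punchIn p k))
      ≡⟨ cong₂ (λ u v → M i p * u + v) (insertAt-lookup (λ k → a * y k) p (- s))
           (sumℤ-cong (λ k → trans (cong (M i (punchIn p k) *_) (insertAt-punchIn (λ k → a * y k) p (- s) k)) (commute (M i (punchIn p k)) a (y k)))) ⟩
    M i p * - s + sumℤ (λ k → a * (M i (punchIn p k) * y k))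
      ≡⟨ cong (_+_ (M i p * - s)) (sumℤ-*ˡ a (λ k → M i (punchIn p k) * y k)) ⟩
    M i p * - s + a * sumℤ (λ k → M i (punchIn p k) * y k) ∎
  cancel : ∀ a s → a * - s + a * s ≡ + 0
  cancel = solve-∀
  spread : ∀ a b c d y → a * (b * y) + - c * (d * y) ≡ (a * b - c * d) * y
  spread = solve-∀
  reorder : ∀ c s a t → c * - s + a * t ≡ a * t + - c * s
  reorder = solve-∀
  Mx≡0 : ∀ i → sumℤ (λ j → M i j * x j) ≡ + 0
  Mx≡0 zero = trans (row zero) (cancel a s)
  Mx≡0 (suc i) = begin
    sumℤ (λ j → M (suc i) j * x j)
      ≡⟨ row (suc i) ⟩
    β * - s + a * sumℤ t
      ≡⟨ reorder β s a (sumℤ t) ⟩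
    a * sumℤ t + - β * s
      ≡⟨ cong₂ _+_ (sumℤ-*ˡ a t) (sumℤ-*ˡ (- β) (λ k → M zero (punchIn p k) * y k)) ⟨
    sumℤ (λ k → a * t k) + sumℤ (λ k → - β * (M zero (punchIn p k) * y k))
      ≡⟨ sumℤ-+ (λ k → a * t k) (λ k → - β * (M zero (punchIn p k) * y k)) ⟨
    sumℤ (λ k → a * t k + - β * (M zero (punchIn p k) * y k))
      ≡⟨ sumℤ-cong (λ k → spread a (M (suc i) (punchIn p k)) β (M zero (punchIn p k)) (y k)) ⟩
    sumℤ (λ k → (a * M (suc i) (punchIn p k) - β * M zero (punchIn p k)) * y k)
      ≡⟨ My≡0 i ⟩
    + 0 ∎
    where
    β : ℤ
    β = M (suc i) p
    t : Fin (suc n) → ℤ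
    t k = M (suc i) (punchIn p k) * y k

-- If a coefficient of the affine function were nonzero, a kernel vector of the remaining rows of
-- the homogenised vertex matrix would be an affine dependency.
affine-function-vanishes : ∀ {d} {A : IntMat d (suc d)} → FullDimSimplex A → (L : Fin d → ℤ) (c : ℤ) →
  (∀ j → sumℤ (λ l → L l * A l j) + c ≡ + 0) → ∀ l → L l ≡ + 0
affine-function-vanishes {d} {A} independent L c vanishing l =
  decidable-stable (L l ℤ.≟ + 0) λ Ll≢0 → dependent Ll≢0 (kernel-vector (Ã ∘ punchIn (suc l)))
  where
  Ã : IntMat (suc d) (suc d)
  Ã zero j = + 1
  Ã (suc i) j = A i j
  Λ : Fin (suc d) → ℤ
  Λ zero = c
  Λ (suc i) = L i
  combination : ∀ j → sumℤ (λ i → Λ i * Ã i j) ≡ + 0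
  combination j = trans (cong (_+ sumℤ (λ i → L i * A i j)) (ℤₚ.*-identityʳ c)) (trans (ℤₚ.+-comm c _) (vanishing j))
  dependent : L l ≢ + 0 → ¬ NonzeroKernel (Ã ∘ punchIn (suc l))
  dependent Ll≢0 (x , (j , xj≢0) , kernel) = xj≢0 (ι-injective (independent (ι ∘ x) sum-x rows-x j))
    where
    other : ∀ k → k ≢ suc l → sumℤ (λ j → Ã k j * x j) ≡ + 0
    other k k≢l = subst (λ r → sumℤ (λ j → Ã r j * x j) ≡ + 0) (punchIn-punchOut (k≢l ∘ sym)) (kernel (punchOut (k≢l ∘ sym)))
    -- Evaluate `Λ` against `Ã x` in two ways: row by row only row `suc l` contributes, while column
    -- by column everything vanishes because `Λ` annihilates each homogenised vertex.
    product : L l * sumℤ (λ j → A l j * x j) ≡ + 0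
    product = begin
      L l * sumℤ (λ j → A l j * x j)
        ≡⟨ sumℤ-single {f = λ k → Λ k * sumℤ (λ j → Ã k j * x j)} (suc l)
             (λ k k≢l → trans (cong (Λ k *_) (other k k≢l)) (ℤₚ.*-zeroʳ (Λ k))) ⟨
      sumℤ (λ k → Λ k * sumℤ (λ j → Ã k j * x j))
        ≡⟨ sumℤ-assoc Λ Ã x ⟩
      sumℤ (λ j → sumℤ (λ k → Λ k * Ã k j) * x j)
        ≡⟨ sumℤ-zero (λ j → cong (_* x j) (combination j)) ⟩
      + 0 ∎
    row-l : sumℤ (λ j → A l j * x j) ≡ + 0
    row-l with ℤₚ.i*j≡0⇒i≡0∨j≡0 (L l) product
    ... | inj₁ Ll≡0 = contradiction Ll≡0 Ll≢0
    ... | inj₂ eq = eq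
    all-rows : ∀ k → sumℤ (λ j → Ã k j * x j) ≡ + 0
    all-rows k with k ≟ suc l
    ... | yes refl = row-l
    ... | no k≢l = other k k≢l
    sum-x : sumℚ (ι ∘ x) ≡ 0ℚ
    sum-x = trans (sym (ι-sum x)) (cong ι (trans (sumℤ-cong (λ j → sym (ℤₚ.*-identityˡ (x j)))) (all-rows zero)))
    rows-x : ∀ i → sumℚ (λ j → ι (x j) ℚ.* ι (A i j)) ≡ 0ℚ
    rows-x i = begin
      sumℚ (λ j → ι (x j) ℚ.* ι (A i j))  ≡⟨ sumℚ-cong (λ j → trans (ℚₚ.*-comm (ι (x j)) (ι (A i j))) (sym (ι-* (A i j) (x j)))) ⟩
      sumℚ (λ j → ι (A i j * x j))        ≡⟨ ι-sum (λ j → A i j * x j) ⟨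
      ι (sumℤ (λ j → A i j * x j))        ≡⟨ cong ι (all-rows (suc i)) ⟩
      0ℚ                                  ∎

-- Integral affine maps

-- Affinity without matrices, so that coordinates may be indexed by `Maybe I` or `I ⊎ Fin m` with no
-- sum over them. The coefficients 1, `c`, `- c` add up to 1, so the constant term survives exactly
-- once.
record IsAffine {I K : Set} (F : (I → ℤ) → K → ℤ) : Set where
  field
    respects : ∀ {x y} → x ≗ y → F x ≗ F y
    combine : ∀ x y z c k → F (λ i → x i + c * (y i - z i)) k ≡ F x k + c * (F y k - F z k)

open IsAffine

origin : {I : Set} → I → ℤ
origin _ = + 0

integral-affine : IntMat n n → (Fin n → ℤ) → (Fin n → ℤ) → Fin n → ℤ
integral-affine M b x i = sumℤ (λ j → M i j * x j) + b i

integral-affine-isAffine : (M : IntMat n n) (b : Fin n → ℤ) → IsAffine (integral-affine M b)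
integral-affine-isAffine M b = record
  { respects = λ eq i → cong (_+ b i) (sumℤ-cong (λ j → cong (M i j *_) (eq j)))
  ; combine = λ x y z c i → begin
      sumℤ (λ j → M i j * (x j + c * (y j - z j))) + b i
        ≡⟨ cong (_+ b i) (sumℤ-cong (λ j → spread (M i j) (x j) c (y j) (z j))) ⟩
      sumℤ (λ j → M i j * x j + c * (M i j * y j + - + 1 * (M i j * z j))) + b i
        ≡⟨ cong (_+ b i) (sumℤ-+ (λ j → M i j * x j) (λ j → c * (M i j * y j + - + 1 * (M i j * z j)))) ⟩
      Mv i x + sumℤ (λ j → c * (M i j * y j + - + 1 * (M i j * z j))) + b i
        ≡⟨ cong (λ u → Mv i x + u + b i) (sumℤ-*ˡ c (λ j → M i j * y j + - + 1 * (M i j * z j))) ⟩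
      Mv i x + c * sumℤ (λ j → M i j * y j + - + 1 * (M i j * z j)) + b i
        ≡⟨ cong (λ u → Mv i x + c * u + b i) (trans (sumℤ-+ (λ j → M i j * y j) (λ j → - + 1 * (M i j * z j))) (cong (_+_ (Mv i y)) (sumℤ-*ˡ (- + 1) (λ j → M i j * z j)))) ⟩
      Mv i x + c * (Mv i y + - + 1 * Mv i z) + b i
        ≡⟨ regroup (Mv i x) c (Mv i y) (Mv i z) (b i) ⟩
      (Mv i x + b i) + c * ((Mv i y + b i) - (Mv i z + b i)) ∎
  }
  where
  Mv : Fin _ → (Fin _ → ℤ) → ℤ
  Mv i x = sumℤ (λ j → M i j * x j)
  spread : ∀ m x c y z → m * (x + c * (y - z)) ≡ m * x + c * (m * y + - + 1 * (m * z))
  spread = solve-∀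
  regroup : ∀ X c Y Z b → X + c * (Y + - + 1 * Z) + b ≡ (X + b) + c * ((Y + b) - (Z + b))
  regroup = solve-∀

affine-sum : {I K : Set} {F : (I → ℤ) → K → ℤ} → IsAffine F → (c : Fin m → ℤ) (v : Fin m → I → ℤ) →
  ∀ k → F (λ i → sumℤ (λ j → c j * v j i)) k ≡ sumℤ (λ j → (F (v j) k - F origin k) * c j) + F origin k
affine-sum {zero} aff c v k = sym (ℤₚ.+-identityˡ _)
affine-sum {suc m} {F = F} aff c v k = begin
  F (λ i → c zero * v zero i + rest i) k
    ≡⟨ respects aff (λ i → shift (c zero) (v zero i) (rest i)) k ⟩
  F (λ i → rest i + c zero * (v zero i - origin i)) k
    ≡⟨ combine aff rest (v zero) origin (c zero) k ⟩
  F rest k + c zero * (F (v zero) k - F origin k)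
    ≡⟨ cong (_+ c zero * (F (v zero) k - F origin k)) (affine-sum aff (c ∘ suc) (v ∘ suc) k) ⟩
  (sumℤ (λ j → (F (v (suc j)) k - F origin k) * c (suc j)) + F origin k) + c zero * (F (v zero) k - F origin k)
    ≡⟨ regroup _ (F origin k) (c zero) (F (v zero) k - F origin k) ⟩
  sumℤ (λ j → (F (v j) k - F origin k) * c j) + F origin k ∎
  where
  rest : _ → ℤ
  rest i = sumℤ (λ j → c (suc j) * v (suc j) i)
  shift : ∀ c v r → c * v + r ≡ r + c * (v - + 0)
  shift = solve-∀
  regroup : ∀ s o c d → (s + o) + c * d ≡ (d * c + s) + o
  regroup = solve-∀

linear-part : ((Fin n → ℤ) → Fin n → ℤ) → IntMat n n
linear-part F i j = F (δ j) i - F origin i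

-- Over `Fin n` a point is a finite combination of unit vectors, so the values at these and at the
-- origin determine the map.
affine-matrix : {F : (Fin n → ℤ) → Fin n → ℤ} → IsAffine F → ∀ x → F x ≗ integral-affine (linear-part F) (F origin) x
affine-matrix aff x i = trans
  (respects aff (λ k → sym (trans (sumℤ-cong (λ j → trans (ℤₚ.*-comm (x j) (δ j k)) (cong (_* x j) (δ-sym j k)))) (sumℤ-δ k x))) i)
  (affine-sum aff x δ i)

-- The maps are only required to be mutually inverse on the vertices; for full-dimensional simplices they
-- are then mutually inverse everywhere.
record LatticeEquiv {I J K : Set} (P : J → I → ℤ) (Q : K → I → ℤ) : Set where
  field
    to from : (I → ℤ) → I → ℤ
    to-affine : IsAffine to
    from-affine : IsAffine from
    image : ∀ j → ∃ λ k → (to (P j) ≗ Q k) × (from (Q k) ≗ P j)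
    preimage : ∀ k → ∃ λ j → (to (P j) ≗ Q k) × (from (Q k) ≗ P j)

open LatticeEquiv

LatticeEquiv-sym : {I J K : Set} {P : J → I → ℤ} {Q : K → I → ℤ} → LatticeEquiv P Q → LatticeEquiv Q P
LatticeEquiv-sym e = record
  { to = from e
  ; from = to e
  ; to-affine = from-affine e
  ; from-affine = to-affine e
  ; image = λ k → let j , p , q = preimage e k in j , q , p
  ; preimage = λ j → let k , p , q = image e j in k , q , p
  }

-- Adding and removing apexes

cone : {I J : Set} → (J → I → ℤ) → Maybe J → Maybe I → ℤ
cone P (just j) (just i) = P j i
cone P (just j) nothing = + 0
cone P nothing (just i) = + 0
cone P nothing nothing = + 1

-- Acting by `F` on the base coordinates and trivially on the height would send the apex to
-- `F origin` at height 1. Subtracting `F origin` once per unit of height fixes the apex and changes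
-- nothing at height 0.
suspend : {I : Set} → ((I → ℤ) → I → ℤ) → (Maybe I → ℤ) → Maybe I → ℤ
suspend F x (just i) = F (x ∘ just) i - x nothing * F origin i
suspend F x nothing = x nothing

suspend-affine : {I : Set} {F : (I → ℤ) → I → ℤ} → IsAffine F → IsAffine (suspend F)
suspend-affine {F = F} aff = record
  { respects = λ { eq (just i) → cong₂ (λ u v → u - v * F origin i) (respects aff (eq ∘ just) i) (eq nothing)
                 ; eq nothing → eq nothing }
  ; combine = λ { x y z c (just i) → trans
                    (cong (_- (x nothing + c * (y nothing - z nothing)) * F origin i) (combine aff (x ∘ just) (y ∘ just) (z ∘ just) c i))
                    (regroup (F (x ∘ just) i) c (F (y ∘ just) i) (F (z ∘ just) i) (x nothing) (y nothing) (z nothing) (F origin i))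
                ; x y z c nothing → refl }
  }
  where
  regroup : ∀ X c Y Z x y z o →
    (X + c * (Y - Z)) - (x + c * (y - z)) * o ≡ (X - x * o) + c * ((Y - y * o) - (Z - z * o))
  regroup = solve-∀

suspend-base : {I J K : Set} {P : J → I → ℤ} {Q : K → I → ℤ} {F : (I → ℤ) → I → ℤ} {j : J} {k : K} →
  F (P j) ≗ Q k → suspend F (cone P (just j)) ≗ cone Q (just k)
suspend-base eq (just i) = trans (ℤₚ.+-identityʳ _) (eq i)
suspend-base eq nothing = refl

suspend-apex : {I J K : Set} {P : J → I → ℤ} {Q : K → I → ℤ} (F : (I → ℤ) → I → ℤ) →
  suspend F (cone P nothing) ≗ cone Q nothing
suspend-apex F (just i) = cancel (F origin i)
  where
  cancel : ∀ o → o - (+ 1) * o ≡ + 0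
  cancel = solve-∀
suspend-apex F nothing = refl

cone-equiv : {I J K : Set} {P : J → I → ℤ} {Q : K → I → ℤ} → LatticeEquiv P Q → LatticeEquiv (cone P) (cone Q)
cone-equiv {P = P} {Q} e = record
  { to = suspend (to e)
  ; from = suspend (from e)
  ; to-affine = suspend-affine (to-affine e)
  ; from-affine = suspend-affine (from-affine e)
  ; image = λ
      { (just j) → let k , p , q = image e j in
          just k , suspend-base {P = P} {Q} p , suspend-base {P = Q} {P} q
      ; nothing → nothing , suspend-apex {P = P} {Q} (to e) , suspend-apex {P = Q} {P} (from e) }
  ; preimage = λ
      { (just k) → let j , p , q = preimage e k in
          just j , suspend-base {P = P} {Q} p , suspend-base {P = Q} {P} q
      ; nothing → nothing , suspend-apex {P = P} {Q} (to e) , suspend-apex {P = Q} {P} (from e) }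
  }

base : {I : Set} → (I → ℤ) → Maybe I → ℤ
base x (just i) = x i
base x nothing = + 0

apex : {I : Set} → Maybe I → ℤ
apex (just i) = + 0
apex nothing = + 1

-- On vertices this is the first-return map: a base vertex sent to the apex is sent on to the image of the apex.
restrict : {I : Set} → ((Maybe I → ℤ) → Maybe I → ℤ) → (I → ℤ) → I → ℤ
restrict F x i = F (base x) (just i) + F (base x) nothing * F apex (just i)

restrict-affine : {I : Set} {F : (Maybe I → ℤ) → Maybe I → ℤ} → IsAffine F → IsAffine (restrict F)
restrict-affine {I} {F} aff = record
  { respects = λ eq i → cong₂ (λ u v → u + v * F apex (just i)) (respects aff (base-cong eq) (just i)) (respects aff (base-cong eq) nothing)
  ; combine = λ x y z c i → trans
      (cong₂ (λ u v → u + v * F apex (just i)) (base-combine x y z c (just i)) (base-combine x y z c nothing))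
      (regroup (F (base x) (just i)) c (F (base y) (just i)) (F (base z) (just i)) (F (base x) nothing) (F (base y) nothing) (F (base z) nothing) (F apex (just i)))
  }
  where
  base-cong : ∀ {x y : I → ℤ} → x ≗ y → base x ≗ base y
  base-cong eq (just i) = eq i
  base-cong eq nothing = refl
  zero-combine : ∀ c → + 0 ≡ + 0 + c * (+ 0 - + 0)
  zero-combine = solve-∀
  base-combine : ∀ x y z c i → F (base (λ i → x i + c * (y i - z i))) i ≡ F (base x) i + c * (F (base y) i - F (base z) i)
  base-combine x y z c i = trans
    (respects aff (λ { (just i) → refl ; nothing → zero-combine c }) i)
    (combine aff (base x) (base y) (base z) c i)
  regroup : ∀ X c Y Z x y z a →
    (X + c * (Y - Z)) + (x + c * (y - z)) * a ≡ (X + x * a) + c * ((Y + y * a) - (Z + z * a))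
  regroup = solve-∀

module _ {I J K : Set} {P : J → I → ℤ} {Q : K → I → ℤ} {F : (Maybe I → ℤ) → Maybe I → ℤ} (aff : IsAffine F) where

  on-base : ∀ {j y} → F (cone P (just j)) ≗ y → F (base (P j)) ≗ y
  on-base eq i = trans (respects aff (λ { (just i) → refl ; nothing → refl }) i) (eq i)

  on-apex : ∀ {y} → F (cone P nothing) ≗ y → F apex ≗ y
  on-apex eq i = trans (respects aff (λ { (just i) → refl ; nothing → refl }) i) (eq i)

  restrict-direct : ∀ {j k} → F (cone P (just j)) ≗ cone Q (just k) → restrict F (P j) ≗ Q k
  restrict-direct {j} {k} eq i = trans
    (cong₂ (λ u v → u + v * F apex (just i)) (on-base eq (just i)) (on-base eq nothing))
    (ℤₚ.+-identityʳ (Q k i))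

  -- The image of the base vertex has zero base part and height 1, so all that remains of the
  -- formula is the image of the apex.
  restrict-return : ∀ {j k} → F (cone P (just j)) ≗ cone Q nothing → F (cone P nothing) ≗ cone Q (just k) →
    restrict F (P j) ≗ Q k
  restrict-return {j} {k} eq eq′ i = trans
    (cong₂ (λ u v → u + v * F apex (just i)) (on-base eq (just i)) (on-base eq nothing))
    (trans (ℤₚ.+-identityˡ _) (trans (ℤₚ.*-identityˡ _) (on-apex eq′ (just i))))

-- If `to` leads from `P j` through the apex to `Q k`, then `from` leads from `Q k` through the apex
-- to `P j`: the detour is reversed, with the same two equations in exchanged roles.
restrict-image : {I J K : Set} {P : J → I → ℤ} {Q : K → I → ℤ} (e : LatticeEquiv (cone P) (cone Q)) →
  ∀ j → ∃ λ k → (restrict (to e) (P j) ≗ Q k) × (restrict (from e) (Q k) ≗ P j)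
restrict-image {P = P} {Q} e j with image e (just j)
... | just k , p , q = k , restrict-direct {P = P} {Q} (to-affine e) p , restrict-direct {P = Q} {P} (from-affine e) q
... | nothing , p , q with image e nothing
...   | just k , p′ , q′ = k , restrict-return {P = P} {Q} (to-affine e) p p′ , restrict-return {P = Q} {P} (from-affine e) q′ q
-- Here `from` would send the apex both to height 0 and to height 1.
...   | nothing , _ , q′ = contradiction (trans (sym (q nothing)) (q′ nothing)) (λ ())

uncone-equiv : {I J K : Set} {P : J → I → ℤ} {Q : K → I → ℤ} → LatticeEquiv (cone P) (cone Q) → LatticeEquiv P Q
uncone-equiv e = record
  { to = restrict (to e)
  ; from = restrict (from e)
  ; to-affine = restrict-affine (to-affine e)
  ; from-affine = restrict-affine (from-affine e)
  ; image = restrict-image e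
  ; preimage = λ k → let j , q , p = restrict-image (LatticeEquiv-sym e) k in j , p , q
  }

-- Coordinates are renamed along `e`, while vertices are matched merely by existence in both
-- directions. That is all `LatticeEquiv` sees of its vertex indices.
record Relabelling {I I′ J J′ : Set} (e : I → I′) (P : J → I → ℤ) (P′ : J′ → I′ → ℤ) : Set where
  constructor relabelling
  field
    ahead : ∀ j → ∃ λ j′ → ∀ i → P j i ≡ P′ j′ (e i)
    back : ∀ j′ → ∃ λ j → ∀ i → P j i ≡ P′ j′ (e i)

open Relabelling

module _ {I I′ : Set} (e : I → I′) (e⁻ : I′ → I) (e∘e⁻ : ∀ i → e (e⁻ i) ≡ i) where

  relabelling-inverse : {J J′ : Set} {P : J → I → ℤ} {P′ : J′ → I′ → ℤ} → Relabelling e P P′ → Relabelling e⁻ P′ P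
  relabelling-inverse {P′ = P′} r = relabelling
    (λ j′ → let j , eq = back r j′ in j , λ i → sym (trans (eq (e⁻ i)) (cong (P′ j′) (e∘e⁻ i))))
    (λ j → let j′ , eq = ahead r j in j′ , λ i → sym (trans (eq (e⁻ i)) (cong (P′ j′) (e∘e⁻ i))))

  conjugate : ((I′ → ℤ) → I′ → ℤ) → (I → ℤ) → I → ℤ
  conjugate F x i = F (x ∘ e⁻) (e i)

  conjugate-affine : {F : (I′ → ℤ) → I′ → ℤ} → IsAffine F → IsAffine (conjugate F)
  conjugate-affine aff = record
    { respects = λ eq i → respects aff (eq ∘ e⁻) (e i)
    ; combine = λ x y z c i → combine aff (x ∘ e⁻) (y ∘ e⁻) (z ∘ e⁻) c (e i)
    }

  conjugate-vertex : {F : (I′ → ℤ) → I′ → ℤ} → IsAffine F → {x y : I → ℤ} {x′ y′ : I′ → ℤ} →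
    (∀ i → x i ≡ x′ (e i)) → (∀ i → y i ≡ y′ (e i)) → F x′ ≗ y′ → conjugate F x ≗ y
  conjugate-vertex aff {x′ = x′} eqx eqy Fx≗y i = trans
    (respects aff (λ i′ → trans (eqx (e⁻ i′)) (cong x′ (e∘e⁻ i′))) (e i))
    (trans (Fx≗y (e i)) (sym (eqy i)))

  relabel : {J J′ K K′ : Set} {P : J → I → ℤ} {P′ : J′ → I′ → ℤ} {Q : K → I → ℤ} {Q′ : K′ → I′ → ℤ} →
    Relabelling e P P′ → Relabelling e Q Q′ → LatticeEquiv P′ Q′ → LatticeEquiv P Q
  relabel r s l = record
    { to = conjugate (to l)
    ; from = conjugate (from l)
    ; to-affine = conjugate-affine (to-affine l)
    ; from-affine = conjugate-affine (from-affine l)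
    ; image = λ j →
        let j′ , eqj = ahead r j
            k′ , p , q = image l j′
            k , eqk = back s k′
        in k , conjugate-vertex (to-affine l) eqj eqk p , conjugate-vertex (from-affine l) eqk eqj q
    ; preimage = λ k →
        let k′ , eqk = ahead s k
            j′ , p , q = preimage l k′
            j , eqj = back r j′
        in j , conjugate-vertex (to-affine l) eqj eqk p , conjugate-vertex (from-affine l) eqk eqj q
    }

relabel-⇔ : {I I′ J J′ K K′ : Set} {P : J → I → ℤ} {P′ : J′ → I′ → ℤ} {Q : K → I → ℤ} {Q′ : K′ → I′ → ℤ}
  (e : I → I′) (e⁻ : I′ → I) → (∀ i → e (e⁻ i) ≡ i) → (∀ i → e⁻ (e i) ≡ i) →
  Relabelling e P P′ → Relabelling e Q Q′ → LatticeEquiv P′ Q′ ⇔ LatticeEquiv P Q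
relabel-⇔ e e⁻ e∘e⁻ e⁻∘e r s = mk⇔
  (relabel e e⁻ e∘e⁻ r s)
  (relabel e⁻ e e⁻∘e (relabelling-inverse e e⁻ e∘e⁻ r) (relabelling-inverse e e⁻ e∘e⁻ s))

-- Iterated cones and the pyramid matrix

multicone : {I J : Set} (m : ℕ) → (J → I → ℤ) → J ⊎ Fin m → I ⊎ Fin m → ℤ
multicone m P (inj₁ j) (inj₁ i) = P j i
multicone m P (inj₁ j) (inj₂ i) = + 0
multicone m P (inj₂ j) (inj₁ i) = + 0
multicone m P (inj₂ j) (inj₂ i) = δ i j

-- Apex `zero` becomes the point added by the outermost `cone`. The same map serves coordinate
-- indices and vertex indices, since every apex brings its own coordinate.
peel : {I : Set} → I ⊎ Fin (suc m) → Maybe (I ⊎ Fin m)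
peel (inj₁ i) = just (inj₁ i)
peel (inj₂ zero) = nothing
peel (inj₂ (suc i)) = just (inj₂ i)

unpeel : {I : Set} → Maybe (I ⊎ Fin m) → I ⊎ Fin (suc m)
unpeel (just (inj₁ i)) = inj₁ i
unpeel (just (inj₂ i)) = inj₂ (suc i)
unpeel nothing = inj₂ zero

peel-unpeel : {I : Set} (i : Maybe (I ⊎ Fin m)) → peel (unpeel i) ≡ i
peel-unpeel (just (inj₁ i)) = refl
peel-unpeel (just (inj₂ i)) = refl
peel-unpeel nothing = refl

unpeel-peel : {I : Set} (i : I ⊎ Fin (suc m)) → unpeel (peel i) ≡ i
unpeel-peel (inj₁ i) = refl
unpeel-peel (inj₂ zero) = refl
unpeel-peel (inj₂ (suc i)) = refl

multicone-peel : {I J : Set} (P : J → I → ℤ) → ∀ j i → multicone (suc m) P j i ≡ cone (multicone m P) (peel j) (peel i)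
multicone-peel P (inj₁ j) (inj₁ i) = refl
multicone-peel P (inj₁ j) (inj₂ zero) = refl
multicone-peel P (inj₁ j) (inj₂ (suc i)) = refl
multicone-peel P (inj₂ zero) (inj₁ i) = refl
multicone-peel P (inj₂ zero) (inj₂ zero) = refl
multicone-peel P (inj₂ zero) (inj₂ (suc i)) = refl
multicone-peel P (inj₂ (suc j)) (inj₁ i) = refl
multicone-peel P (inj₂ (suc j)) (inj₂ zero) = refl
multicone-peel P (inj₂ (suc j)) (inj₂ (suc i)) = refl

relabelling-peel : {I J : Set} (P : J → I → ℤ) → Relabelling peel (multicone (suc m) P) (cone (multicone m P))
relabelling-peel {m} P = relabelling
  (λ j → peel j , multicone-peel P j)
  (λ j′ → unpeel j′ , λ i → trans (multicone-peel P (unpeel j′) i) (cong (λ j → cone (multicone m P) j (peel i)) (peel-unpeel j′)))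

multicone-⇔ : {I J K : Set} {P : J → I → ℤ} {Q : K → I → ℤ} (m : ℕ) →
  LatticeEquiv P Q ⇔ LatticeEquiv (multicone m P) (multicone m Q)
multicone-⇔ {P = P} {Q} zero = relabel-⇔ unplus inj₁ (λ _ → refl) (λ { (inj₁ _) → refl }) (plus0 P) (plus0 Q)
  where
  unplus : {I : Set} → I ⊎ Fin 0 → I
  unplus (inj₁ i) = i
  plus0 : {I J : Set} (P : J → I → ℤ) → Relabelling unplus (multicone 0 P) P
  plus0 P = relabelling (λ { (inj₁ j) → j , λ { (inj₁ i) → refl } }) (λ j → inj₁ j , λ { (inj₁ i) → refl })
multicone-⇔ {P = P} {Q} (suc m) = mk⇔
  (Equivalence.to peeled ∘ cone-equiv ∘ Equivalence.to (multicone-⇔ m))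
  (Equivalence.from (multicone-⇔ m) ∘ uncone-equiv ∘ Equivalence.from peeled)
  where
  peeled : LatticeEquiv (cone (multicone m P)) (cone (multicone m Q)) ⇔ LatticeEquiv (multicone (suc m) P) (multicone (suc m) Q)
  peeled = relabel-⇔ peel unpeel peel-unpeel unpeel-peel (relabelling-peel P) (relabelling-peel Q)

columns : ∀ {r c} → IntMat r c → Fin c → Fin r → ℤ
columns A j i = A i j

pyramid-multicone : ∀ {d} m (A : IntMat d (suc d)) i j →
  pyramid m A i j ≡ multicone m (columns A) (splitAt (suc d) j) (splitAt d i)
pyramid-multicone {d} m A i j with splitAt d i | splitAt (suc d) j
... | inj₁ _ | inj₁ _ = refl
... | inj₁ _ | inj₂ _ = refl
... | inj₂ _ | inj₁ _ = refl
... | inj₂ i′ | inj₂ j′ with i′ ≟ j′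
...   | yes _ = refl
...   | no _ = refl

pyramid-⇔ : ∀ {d} m (A B : IntMat d (suc d)) →
  LatticeEquiv (columns A) (columns B) ⇔ LatticeEquiv (columns (pyramid m A)) (columns (pyramid m B))
pyramid-⇔ {d} m A B = mk⇔
  (Equivalence.to split ∘ Equivalence.to (multicone-⇔ m))
  (Equivalence.from (multicone-⇔ m) ∘ Equivalence.from split)
  where
  relabelled : (A : IntMat d (suc d)) → Relabelling (splitAt d) (columns (pyramid m A)) (multicone m (columns A))
  relabelled A = relabelling
    (λ j → splitAt (suc d) j , λ i → pyramid-multicone m A i j)
    (λ j′ → join (suc d) m j′ , λ i → trans (pyramid-multicone m A i (join (suc d) m j′))
      (cong (λ j → multicone m (columns A) j (splitAt d i)) (splitAt-join (suc d) m j′)))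
  split : LatticeEquiv (multicone m (columns A)) (multicone m (columns B)) ⇔ LatticeEquiv (columns (pyramid m A)) (columns (pyramid m B))
  split = relabel-⇔ (splitAt d) (join d m) (splitAt-join d m) (join-splitAt d m) (relabelled A) (relabelled B)

-- Convex hulls

integral-affine-∘ : (N M : IntMat n n) (c b x : Fin n → ℤ) → ∀ i →
  integral-affine N c (integral-affine M b x) i ≡
  sumℤ (λ l → sumℤ (λ k → N i k * M k l) * x l) + (sumℤ (λ k → N i k * b k) + c i)
integral-affine-∘ N M c b x i = begin
  sumℤ (λ k → N i k * (sumℤ (λ l → M k l * x l) + b k)) + c i
    ≡⟨ cong (_+ c i) (sumℤ-cong (λ k → ℤₚ.*-distribˡ-+ (N i k) _ (b k))) ⟩
  sumℤ (λ k → N i k * sumℤ (λ l → M k l * x l) + N i k * b k) + c i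
    ≡⟨ cong (_+ c i) (sumℤ-+ (λ k → N i k * sumℤ (λ l → M k l * x l)) (λ k → N i k * b k)) ⟩
  (sumℤ (λ k → N i k * sumℤ (λ l → M k l * x l)) + sumℤ (λ k → N i k * b k)) + c i
    ≡⟨ cong (λ u → (u + sumℤ (λ k → N i k * b k)) + c i) (sumℤ-assoc (N i) M x) ⟩
  (sumℤ (λ l → sumℤ (λ k → N i k * M k l) * x l) + sumℤ (λ k → N i k * b k)) + c i
    ≡⟨ ℤₚ.+-assoc (sumℤ (λ l → sumℤ (λ k → N i k * M k l) * x l)) (sumℤ (λ k → N i k * b k)) (c i) ⟩
  sumℤ (λ l → sumℤ (λ k → N i k * M k l) * x l) + (sumℤ (λ k → N i k * b k) + c i) ∎

+≡0⇒≡0 : ∀ {p q} → 0ℚ ℚ.≤ p → 0ℚ ℚ.≤ q → p ℚ.+ q ≡ 0ℚ → p ≡ 0ℚ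
+≡0⇒≡0 {p} {q} 0≤p 0≤q eq = ℚₚ.≤-antisym
  (subst₂ ℚ._≤_ (ℚₚ.+-identityʳ p) eq (ℚₚ.+-monoʳ-≤ p 0≤q)) 0≤p

sumℚ-nonneg : {f : Fin n → ℚ} → (∀ i → 0ℚ ℚ.≤ f i) → 0ℚ ℚ.≤ sumℚ f
sumℚ-nonneg {zero} _ = ℚₚ.≤-refl
sumℚ-nonneg {suc n} nonneg = ℚₚ.+-mono-≤ (nonneg zero) (sumℚ-nonneg (nonneg ∘ suc))

sumℚ≡0⇒≡0 : {f : Fin n → ℚ} → (∀ i → 0ℚ ℚ.≤ f i) → sumℚ f ≡ 0ℚ → ∀ i → f i ≡ 0ℚ
sumℚ≡0⇒≡0 nonneg eq zero = +≡0⇒≡0 (nonneg zero) (sumℚ-nonneg (nonneg ∘ suc)) eq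
sumℚ≡0⇒≡0 {f = f} nonneg eq (suc i) = sumℚ≡0⇒≡0 (nonneg ∘ suc)
  (+≡0⇒≡0 (sumℚ-nonneg (nonneg ∘ suc)) (nonneg zero) (trans (ℚₚ.+-comm (sumℚ (f ∘ suc)) (f zero)) eq)) i

nonzero-term : {f : Fin n → ℚ} → sumℚ f ≢ 0ℚ → ∃ λ i → f i ≢ 0ℚ
nonzero-term {f = f} sum≢0 with any? (λ i → ¬? (f i ℚ.≟ 0ℚ))
... | yes found = found
... | no none = contradiction (sumℚ-zero (λ i → decidable-stable (f i ℚ.≟ 0ℚ) (λ nz → none (i , nz)))) sum≢0

*-nonneg : ∀ {p q} → 0ℚ ℚ.≤ p → 0ℚ ℚ.≤ q → 0ℚ ℚ.≤ p ℚ.* q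
*-nonneg {p} {q} 0≤p 0≤q = subst (ℚ._≤ p ℚ.* q) (ℚₚ.*-zeroʳ p) (ℚₚ.*-monoˡ-≤-nonNeg p ⦃ ℚ.nonNegative 0≤p ⦄ 0≤q)

*≡0⇒≡0 : ∀ {p q} → p ≢ 0ℚ → p ℚ.* q ≡ 0ℚ → q ≡ 0ℚ
*≡0⇒≡0 {p} {q} p≢0 eq = begin
  q                        ≡⟨ ℚₚ.*-identityˡ q ⟨
  1ℚ ℚ.* q                 ≡⟨ cong (ℚ._* q) (ℚₚ.*-inverseˡ p) ⟨
  (ℚ.1/ p ℚ.* p) ℚ.* q     ≡⟨ ℚₚ.*-assoc (ℚ.1/ p) p q ⟩
  ℚ.1/ p ℚ.* (p ℚ.* q)     ≡⟨ cong (ℚ.1/ p ℚ.*_) eq ⟩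
  ℚ.1/ p ℚ.* 0ℚ            ≡⟨ ℚₚ.*-zeroʳ (ℚ.1/ p) ⟩
  0ℚ                       ∎
  where instance _ = ℚ.≢-nonZero p≢0

vertex : IntMat k c → Fin c → Point k
vertex V j i = ι (V i j)

δℚ-nonneg : (i j : Fin n) → 0ℚ ℚ.≤ δℚ i j
δℚ-nonneg i j with i ≟ j
... | yes _ = ℚₚ.nonNegative⁻¹ 1ℚ
... | no _ = ℚₚ.≤-refl

sumℚ-δℚ : (i : Fin n) → sumℚ (δℚ i) ≡ 1ℚ
sumℚ-δℚ i = trans (sumℚ-cong (λ j → sym (ℚₚ.*-identityʳ (δℚ i j)))) (sumℚ-δ i (λ _ → 1ℚ))

vertex∈conv : (V : IntMat k c) (j : Fin c) → InConv V (vertex V j)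
vertex∈conv V j = δℚ j , δℚ-nonneg j , sumℚ-δℚ j , λ i → sym (sumℚ-δ j (λ l → ι (V i l)))

InConv-resp : {V : IntMat k c} {x y : Point k} → x ≗ y → InConv V x → InConv V y
InConv-resp eq (w , nonneg , total , point) = w , nonneg , total , λ i → trans (sym (eq i)) (point i)

sumℚ-weights : (w : Fin m → ℚ) (s : Fin m → Fin n → ℚ) → sumℚ w ≡ 1ℚ → (∀ j → sumℚ (s j) ≡ 1ℚ) →
  sumℚ (λ l → sumℚ (λ j → w j ℚ.* s j l)) ≡ 1ℚ
sumℚ-weights w s total totals = begin
  sumℚ (λ l → sumℚ (λ j → w j ℚ.* s j l))  ≡⟨ sumℚ-swap (λ j l → w j ℚ.* s j l) ⟨
  sumℚ (λ j → sumℚ (λ l → w j ℚ.* s j l))  ≡⟨ sumℚ-cong (λ j → trans (sumℚ-*ˡ (w j) (s j)) (trans (cong (w j ℚ.*_) (totals j)) (ℚₚ.*-identityʳ (w j)))) ⟩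
  sumℚ w                                   ≡⟨ total ⟩
  1ℚ                                       ∎

-- The weights of the combination are the product of the row `w` with the matrix of the weights of
-- the points.
InConv-convex : {V : IntMat k c} (p : Fin m → Point k) → (∀ j → InConv V (p j)) →
  (w : Fin m → ℚ) → (∀ j → 0ℚ ℚ.≤ w j) → sumℚ w ≡ 1ℚ → InConv V (λ i → sumℚ (λ j → w j ℚ.* p j i))
InConv-convex {V = V} p p∈ w nonneg total =
  (λ l → sumℚ (λ j → w j ℚ.* s j l)) ,
  (λ l → sumℚ-nonneg (λ j → *-nonneg (nonneg j) (proj₁ (proj₂ (p∈ j)) l))) ,
  sumℚ-weights w s total (λ j → proj₁ (proj₂ (proj₂ (p∈ j)))) ,
  λ i → trans (sumℚ-cong (λ j → cong (w j ℚ.*_) (proj₂ (proj₂ (proj₂ (p∈ j))) i))) (sumℚ-assoc w s (λ l → ι (V i l)))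
  where
  s : _ → _ → ℚ
  s j = proj₁ (p∈ j)

affine-resp : (U : IntMat k k) (b : Fin k → ℤ) {x y : Point k} → x ≗ y → affine U b x ≗ affine U b y
affine-resp U b eq i = cong (ℚ._+ ι (b i)) (sumℚ-cong (λ j → cong (ι (U i j) ℚ.*_) (eq j)))

affine-ι : (U : IntMat k k) (b : Fin k → ℤ) (x : Fin k → ℤ) → affine U b (ι ∘ x) ≗ ι ∘ integral-affine U b x
affine-ι U b x i = sym (begin
  ι (sumℤ (λ j → U i j * x j) + b i)             ≡⟨ ι-+ (sumℤ (λ j → U i j * x j)) (b i) ⟩
  ι (sumℤ (λ j → U i j * x j)) ℚ.+ ι (b i)       ≡⟨ cong (ℚ._+ ι (b i)) (ι-sum (λ j → U i j * x j)) ⟩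
  sumℚ (λ j → ι (U i j * x j)) ℚ.+ ι (b i)       ≡⟨ cong (ℚ._+ ι (b i)) (sumℚ-cong (λ j → ι-* (U i j) (x j))) ⟩
  sumℚ (λ j → ι (U i j) ℚ.* ι (x j)) ℚ.+ ι (b i) ∎)

affine-barycentric : (U : IntMat k k) (b : Fin k → ℤ) (w : Fin m → ℚ) (p : Fin m → Point k) → sumℚ w ≡ 1ℚ → ∀ i →
  affine U b (λ l → sumℚ (λ j → w j ℚ.* p j l)) i ≡ sumℚ (λ j → w j ℚ.* affine U b (p j) i)
affine-barycentric U b w p total i = sym (begin
  sumℚ (λ j → w j ℚ.* (sumℚ (λ l → ι (U i l) ℚ.* p j l) ℚ.+ ι (b i)))
    ≡⟨ sumℚ-cong (λ j → ℚₚ.*-distribˡ-+ (w j) _ (ι (b i))) ⟩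
  sumℚ (λ j → w j ℚ.* sumℚ (λ l → ι (U i l) ℚ.* p j l) ℚ.+ w j ℚ.* ι (b i))
    ≡⟨ sumℚ-+ (λ j → w j ℚ.* sumℚ (λ l → ι (U i l) ℚ.* p j l)) (λ j → w j ℚ.* ι (b i)) ⟩
  sumℚ (λ j → w j ℚ.* sumℚ (λ l → ι (U i l) ℚ.* p j l)) ℚ.+ sumℚ (λ j → w j ℚ.* ι (b i))
    ≡⟨ cong₂ ℚ._+_ linear constant ⟩
  affine U b (λ l → sumℚ (λ j → w j ℚ.* p j l)) i ∎)
  where
  linear : sumℚ (λ j → w j ℚ.* sumℚ (λ l → ι (U i l) ℚ.* p j l)) ≡ sumℚ (λ l → ι (U i l) ℚ.* sumℚ (λ j → w j ℚ.* p j l))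
  linear = begin
    sumℚ (λ j → w j ℚ.* sumℚ (λ l → ι (U i l) ℚ.* p j l))
      ≡⟨ sumℚ-cong (λ j → cong (w j ℚ.*_) (sumℚ-cong (λ l → ℚₚ.*-comm (ι (U i l)) (p j l)))) ⟩
    sumℚ (λ j → w j ℚ.* sumℚ (λ l → p j l ℚ.* ι (U i l)))
      ≡⟨ sumℚ-assoc w p (λ l → ι (U i l)) ⟩
    sumℚ (λ l → sumℚ (λ j → w j ℚ.* p j l) ℚ.* ι (U i l))
      ≡⟨ sumℚ-cong (λ l → ℚₚ.*-comm (sumℚ (λ j → w j ℚ.* p j l)) (ι (U i l))) ⟩
    sumℚ (λ l → ι (U i l) ℚ.* sumℚ (λ j → w j ℚ.* p j l)) ∎
  constant : sumℚ (λ j → w j ℚ.* ι (b i)) ≡ ι (b i)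
  constant = trans (sumℚ-*ʳ (ι (b i)) w) (trans (cong (ℚ._* ι (b i)) total) (ℚₚ.*-identityˡ (ι (b i))))

-- The difference of the two coordinate vectors is an affine dependency.
barycentric-unique : {V : IntMat k c} → AffinelyIndependent V → (p q : Fin c → ℚ) → sumℚ p ≡ sumℚ q →
  (∀ i → sumℚ (λ j → p j ℚ.* ι (V i j)) ≡ sumℚ (λ j → q j ℚ.* ι (V i j))) → p ≗ q
barycentric-unique {V = V} independent p q totals points j = begin
  p j                              ≡⟨ ℚₚ.+-identityʳ (p j) ⟨
  p j ℚ.+ 0ℚ                       ≡⟨ cong (p j ℚ.+_) (ℚₚ.+-inverseˡ (q j)) ⟨
  p j ℚ.+ (ℚ.- q j ℚ.+ q j)        ≡⟨ ℚₚ.+-assoc (p j) (ℚ.- q j) (q j) ⟨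
  (p j ℚ.- q j) ℚ.+ q j            ≡⟨ cong (ℚ._+ q j) (independent (λ j → p j ℚ.- q j) total rows j) ⟩
  0ℚ ℚ.+ q j                       ≡⟨ ℚₚ.+-identityˡ (q j) ⟩
  q j                              ∎
  where
  sumℚ-neg : (f : Fin n → ℚ) → sumℚ (λ j → ℚ.- f j) ≡ ℚ.- sumℚ f
  sumℚ-neg {zero} f = refl
  sumℚ-neg {suc n} f = trans (cong (ℚ.- f zero ℚ.+_) (sumℚ-neg (f ∘ suc))) (sym (ℚₚ.neg-distrib-+ (f zero) (sumℚ (f ∘ suc))))
  difference : (f g : Fin n → ℚ) → sumℚ f ≡ sumℚ g → sumℚ (λ j → f j ℚ.- g j) ≡ 0ℚ
  difference f g eq = begin
    sumℚ (λ j → f j ℚ.- g j)               ≡⟨ sumℚ-+ f (λ j → ℚ.- g j) ⟩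
    sumℚ f ℚ.+ sumℚ (λ j → ℚ.- g j)        ≡⟨ cong₂ ℚ._+_ eq (sumℚ-neg g) ⟩
    sumℚ g ℚ.- sumℚ g                      ≡⟨ ℚₚ.+-inverseʳ (sumℚ g) ⟩
    0ℚ                                     ∎
  total : sumℚ (λ j → p j ℚ.- q j) ≡ 0ℚ
  total = difference p q totals
  rows : ∀ i → sumℚ (λ j → (p j ℚ.- q j) ℚ.* ι (V i j)) ≡ 0ℚ
  rows i = trans
    (sumℚ-cong (λ j → trans (ℚₚ.*-distribʳ-+ (ι (V i j)) (p j) (ℚ.- q j))
      (cong (p j ℚ.* ι (V i j) ℚ.+_) (sym (ℚₚ.neg-distribˡ-* (q j) (ι (V i j)))))))
    (difference (λ j → p j ℚ.* ι (V i j)) (λ j → q j ℚ.* ι (V i j)) (points i))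

-- Writing s and t for the barycentric coordinates of the images of the vertices of V and of the
-- preimages of those of W, independence makes t s the identity, so s and t are permutation matrices.
same-hull⇒lattice : {V W : IntMat k c} → AffinelyIndependent W →
  (N U : IntMat k k) (b : Fin k → ℤ) → N InverseOf U →
  ((y : Point k) → (Σ (Point k) λ x → InConv V x × ((i : Fin k) → y i ≡ affine U b x i)) ⇔ InConv W y) →
  LatticeEquiv (columns V) (columns W)
same-hull⇒lattice {k} {c} {V} {W} independent N U b NU≡1 same = record
  { to = integral-affine U b
  ; from = integral-affine N b⁻
  ; to-affine = integral-affine-isAffine U b
  ; from-affine = integral-affine-isAffine N b⁻
  ; image = hit
  ; preimage = λ j → source j , matched j , returned j
  }
  where
  b⁻ : Fin k → ℤ
  b⁻ i = - sumℤ (λ j → N i j * b j)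

  left-inverse : ∀ x → integral-affine N b⁻ (integral-affine U b x) ≗ x
  left-inverse x i = begin
    integral-affine N b⁻ (integral-affine U b x) i
      ≡⟨ integral-affine-∘ N U b⁻ b x i ⟩
    sumℤ (λ l → sumℤ (λ k → N i k * U k l) * x l) + (sumℤ (λ j → N i j * b j) + b⁻ i)
      ≡⟨ cong₂ _+_ (sumℤ-cong (λ l → cong (_* x l) (NU≡1 i l))) (ℤₚ.+-inverseʳ (sumℤ (λ j → N i j * b j))) ⟩
    sumℤ (λ l → δ i l * x l) + + 0
      ≡⟨ ℤₚ.+-identityʳ (sumℤ (λ l → δ i l * x l)) ⟩
    sumℤ (λ l → δ i l * x l)
      ≡⟨ sumℤ-δ i x ⟩
    x i ∎

  φ : Point k → Point k
  φ = affine U b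

  image-in-W : ∀ l → InConv W (φ (vertex V l))
  image-in-W l = Equivalence.to (same (φ (vertex V l))) (vertex V l , vertex∈conv V l , λ _ → refl)
  preimage-in-V : ∀ j → Σ (Point k) λ x → InConv V x × (vertex W j ≗ φ x)
  preimage-in-V j = Equivalence.from (same (vertex W j)) (vertex∈conv W j)

  s t : Fin c → Fin c → ℚ
  s l = proj₁ (image-in-W l)
  t j = proj₁ (proj₁ (proj₂ (preimage-in-V j)))

  s-nonneg : ∀ l i → 0ℚ ℚ.≤ s l i
  s-nonneg l = proj₁ (proj₂ (image-in-W l))
  s-total : ∀ l → sumℚ (s l) ≡ 1ℚ
  s-total l = proj₁ (proj₂ (proj₂ (image-in-W l)))
  s-point : ∀ l i → φ (vertex V l) i ≡ sumℚ (λ j → s l j ℚ.* ι (W i j))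
  s-point l = proj₂ (proj₂ (proj₂ (image-in-W l)))
  t-nonneg : ∀ j l → 0ℚ ℚ.≤ t j l
  t-nonneg j = proj₁ (proj₂ (proj₁ (proj₂ (preimage-in-V j))))
  t-total : ∀ j → sumℚ (t j) ≡ 1ℚ
  t-total j = proj₁ (proj₂ (proj₂ (proj₁ (proj₂ (preimage-in-V j)))))

  t-point : ∀ j i → vertex W j i ≡ sumℚ (λ l → t j l ℚ.* φ (vertex V l) i)
  t-point j i = begin
    vertex W j i                                                 ≡⟨ proj₂ (proj₂ (preimage-in-V j)) i ⟩
    φ (proj₁ (preimage-in-V j)) i                                ≡⟨ affine-resp U b (proj₂ (proj₂ (proj₂ (proj₁ (proj₂ (preimage-in-V j)))))) i ⟩
    φ (λ r → sumℚ (λ l → t j l ℚ.* vertex V l r)) i              ≡⟨ affine-barycentric U b (t j) (vertex V) (t-total j) i ⟩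
    sumℚ (λ l → t j l ℚ.* φ (vertex V l) i)                      ∎

  -- Both sides are barycentric coordinates of vertex `j` of `W` with respect to the vertices of
  -- `W`.
  ts≡1 : ∀ j i → sumℚ (λ l → t j l ℚ.* s l i) ≡ δℚ j i
  ts≡1 j = barycentric-unique {V = W} independent (λ i → sumℚ (λ l → t j l ℚ.* s l i)) (δℚ j)
    (trans (sumℚ-weights (t j) s (t-total j) s-total) (sym (sumℚ-δℚ j)))
    λ i → begin
      sumℚ (λ r → sumℚ (λ l → t j l ℚ.* s l r) ℚ.* ι (W i r))  ≡⟨ sumℚ-assoc (t j) s (λ r → ι (W i r)) ⟨
      sumℚ (λ l → t j l ℚ.* sumℚ (λ r → s l r ℚ.* ι (W i r)))  ≡⟨ sumℚ-cong (λ l → cong (t j l ℚ.*_) (s-point l i)) ⟨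
      sumℚ (λ l → t j l ℚ.* φ (vertex V l) i)                  ≡⟨ t-point j i ⟨
      ι (W i j)                                                ≡⟨ sumℚ-δ j (λ r → ι (W i r)) ⟨
      sumℚ (λ r → δℚ j r ℚ.* ι (W i r))                        ∎

  positive : ∀ j → ∃ λ l → t j l ≢ 0ℚ
  positive j = nonzero-term (λ eq → contradiction (trans (sym (t-total j)) eq) (λ ()))

  source : Fin c → Fin c
  source j = proj₁ (positive j)

  -- An off-diagonal entry of the product is a sum of nonnegative terms equal to 0, so each term is
  -- 0; the factor `t j (source j)` is nonzero by choice. Hence row `source j` of `s` is a unit
  -- vector.
  s-off : ∀ j i → i ≢ j → s (source j) i ≡ 0ℚ
  s-off j i i≢j = *≡0⇒≡0 (proj₂ (positive j))
    (sumℚ≡0⇒≡0 {f = λ l → t j l ℚ.* s l i} (λ l → *-nonneg (t-nonneg j l) (s-nonneg l i)) (trans (ts≡1 j i) (δℚ-off (i≢j ∘ sym))) (source j))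

  s-on : ∀ j → s (source j) j ≡ 1ℚ
  s-on j = trans (sym (sumℚ-single {f = s (source j)} j (s-off j))) (s-total (source j))

  matched : ∀ j → integral-affine U b (columns V (source j)) ≗ columns W j
  matched j i = ι-injective (begin
    ι (integral-affine U b (columns V (source j)) i)        ≡⟨ affine-ι U b (columns V (source j)) i ⟨
    φ (vertex V (source j)) i                               ≡⟨ s-point (source j) i ⟩
    sumℚ (λ r → s (source j) r ℚ.* ι (W i r))               ≡⟨ sumℚ-single {f = λ r → s (source j) r ℚ.* ι (W i r)} j (λ r r≢j → trans (cong (ℚ._* ι (W i r)) (s-off j r r≢j)) (ℚₚ.*-zeroˡ (ι (W i r)))) ⟩
    s (source j) j ℚ.* ι (W i j)                            ≡⟨ cong (ℚ._* ι (W i j)) (s-on j) ⟩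
    1ℚ ℚ.* ι (W i j)                                        ≡⟨ ℚₚ.*-identityˡ (ι (W i j)) ⟩
    ι (W i j)                                               ∎)

  returned : ∀ j → integral-affine N b⁻ (columns W j) ≗ columns V (source j)
  returned j i = trans
    (respects (integral-affine-isAffine N b⁻) (λ r → sym (matched j r)) i)
    (left-inverse (columns V (source j)) i)

  -- If `source` missed `l`, two distinct `i` and `j` would share a source, and the same entry of
  -- `s` would be both 0 and 1.
  hit : ∀ l → ∃ λ j → (integral-affine U b (columns V l) ≗ columns W j) × (integral-affine N b⁻ (columns W j) ≗ columns V l)
  hit l = by-cases (hit-or-repeat source l)
    where
    by-cases : (∃ λ j → source j ≡ l) ⊎ (∃₂ λ i j → i ≢ j × source i ≡ source j) →
      ∃ λ j → (integral-affine U b (columns V l) ≗ columns W j) × (integral-affine N b⁻ (columns W j) ≗ columns V l)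
    by-cases (inj₁ (j , refl)) = j , matched j , returned j
    by-cases (inj₂ (i , j , i≢j , eq)) = contradiction
      (trans (sym (s-off i j (i≢j ∘ sym))) (trans (cong (λ l → s l j) eq) (s-on j))) (λ ())

unimodular⇒lattice : {V W : IntMat k c} → AffinelyIndependent W → UnimodEquiv V W →
  LatticeEquiv (columns V) (columns W)
unimodular⇒lattice {V = V} {W} independent (U , b , unimodular , same) =
  let N , NU≡1 = unimodular⇒invertible {U = U} unimodular in same-hull⇒lattice {V = V} {W} independent N U b NU≡1 same

-- The matrix of `to` gives the equivalence, and that of `from` certifies its determinant. The hulls
-- correspond because affine maps preserve barycentric weights and vertices are matched in both
-- directions.
lattice⇒unimodular : ∀ {d} {V : IntMat d (suc d)} {W : IntMat d c} → FullDimSimplex V →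
  LatticeEquiv (columns V) (columns W) → UnimodEquiv V W
lattice⇒unimodular {d = d} {V} {W} independent e = M , b , invertible⇒unimodular {N = N} NM≡1 , λ y → mk⇔ into (onto y)
  where
  M N : IntMat d d
  M = linear-part (to e)
  N = linear-part (from e)
  b b⁻ : Fin d → ℤ
  b = to e origin
  b⁻ = from e origin

  fixed : ∀ j → integral-affine N b⁻ (integral-affine M b (columns V j)) ≗ columns V j
  fixed j i = begin
    integral-affine N b⁻ (integral-affine M b (columns V j)) i  ≡⟨ affine-matrix (from-affine e) _ i ⟨
    from e (integral-affine M b (columns V j)) i                ≡⟨ respects (from-affine e) (λ r → trans (sym (affine-matrix (to-affine e) (columns V j) r)) (p r)) i ⟩
    from e (columns W (proj₁ (image e j))) i                    ≡⟨ q i ⟩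
    V i j                                                       ∎
    where
    p = proj₁ (proj₂ (image e j))
    q = proj₂ (proj₂ (image e j))

  NM : IntMat d d
  NM i l = sumℤ (λ k → N i k * M k l)

  -- Coordinate `i` of the composite minus the identity is an integral affine function that vanishes
  -- at all vertices of `V`, so its linear part, row `i` of `NM - δ`, is zero.
  NM≡1 : N InverseOf M
  NM≡1 i l = ℤₚ.i-j≡0⇒i≡j (NM i l) (δ i l)
    (affine-function-vanishes {A = V} independent (λ l → NM i l - δ i l) (sumℤ (λ k → N i k * b k) + b⁻ i) vanishing l)
    where
    minus : ∀ a b x → (a - b) * x ≡ a * x + - + 1 * (b * x)
    minus = solve-∀
    regroup : ∀ s v r → (s + - + 1 * v) + r ≡ (s + r) - v
    regroup = solve-∀
    vanishing : ∀ j → sumℤ (λ l → (NM i l - δ i l) * V l j) + (sumℤ (λ k → N i k * b k) + b⁻ i) ≡ + 0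
    vanishing j = begin
      sumℤ (λ l → (NM i l - δ i l) * V l j) + r
        ≡⟨ cong (_+ r) (sumℤ-cong (λ l → minus (NM i l) (δ i l) (V l j))) ⟩
      sumℤ (λ l → NM i l * V l j + - + 1 * (δ i l * V l j)) + r
        ≡⟨ cong (_+ r) (sumℤ-+ (λ l → NM i l * V l j) (λ l → - + 1 * (δ i l * V l j))) ⟩
      (sumℤ (λ l → NM i l * V l j) + sumℤ (λ l → - + 1 * (δ i l * V l j))) + r
        ≡⟨ cong (λ u → (sumℤ (λ l → NM i l * V l j) + u) + r) (trans (sumℤ-*ˡ (- + 1) (λ l → δ i l * V l j)) (cong (- + 1 *_) (sumℤ-δ i (columns V j)))) ⟩
      (sumℤ (λ l → NM i l * V l j) + - + 1 * V i j) + r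
        ≡⟨ regroup (sumℤ (λ l → NM i l * V l j)) (V i j) r ⟩
      (sumℤ (λ l → NM i l * V l j) + r) - V i j
        ≡⟨ cong (_- V i j) (trans (sym (integral-affine-∘ N M b⁻ b (columns V j) i)) (fixed j i)) ⟩
      V i j - V i j
        ≡⟨ ℤₚ.+-inverseʳ (V i j) ⟩
      + 0 ∎
      where
      r : ℤ
      r = sumℤ (λ k → N i k * b k) + b⁻ i

  φ-vertex : ∀ {j l} → to e (columns V j) ≗ columns W l → affine M b (vertex V j) ≗ vertex W l
  φ-vertex {j} eq i = trans (affine-ι M b (columns V j) i)
    (cong ι (trans (sym (affine-matrix (to-affine e) (columns V j) i)) (eq i)))

  into : ∀ {y} → (Σ (Point d) λ x → InConv V x × (y ≗ affine M b x)) → InConv W y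
  into {y} (x , (w , nonneg , total , point) , y≗φx) = InConv-resp {V = W}
    (λ i → sym (trans (y≗φx i) (trans (affine-resp M b point i) (affine-barycentric M b w (vertex V) total i))))
    (InConv-convex {V = W} (λ j → affine M b (vertex V j))
      (λ j → let l , p , _ = image e j in InConv-resp {V = W} (λ i → sym (φ-vertex p i)) (vertex∈conv W l))
      w nonneg total)

  -- The weights of `y` are carried over unchanged to the chosen preimages of the vertices of `W`.
  onto : ∀ y → InConv W y → Σ (Point d) λ x → InConv V x × (y ≗ affine M b x)
  onto y (w , nonneg , total , point) =
    (λ i → sumℚ (λ l → w l ℚ.* vertex V (j l) i)) ,
    InConv-convex {V = V} (vertex V ∘ j) (vertex∈conv V ∘ j) w nonneg total ,
    λ i → trans (point i) (sym (trans (affine-barycentric M b w (vertex V ∘ j) total i)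
      (sumℚ-cong (λ l → cong (w l ℚ.*_) (φ-vertex (proj₁ (proj₂ (preimage e l))) i)))))
    where
    j : Fin _ → Fin (suc d)
    j l = proj₁ (preimage e l)

-- Each apex row has a single nonzero entry, in its own apex column, and so kills that coefficient
-- of a dependency. What remains is a dependency among the columns of `A`.
pyramid-independent : ∀ {d} m {A : IntMat d (suc d)} → AffinelyIndependent A → AffinelyIndependent (pyramid m A)
pyramid-independent {d} m {A} independent μ total rows j = by-cases (splitAt (suc d) j) refl
  where
  P : IntMat (d ℕ.+ m) (suc d ℕ.+ m)
  P = pyramid m A

  apex-row : ∀ l j → P (d ↑ʳ l) j ≡ multicone m (columns A) (splitAt (suc d) j) (inj₂ l)
  apex-row l j = trans (pyramid-multicone m A (d ↑ʳ l) j) (cong (multicone m (columns A) (splitAt (suc d) j)) (splitAt-↑ʳ d m l))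

  apex-row-off : ∀ l j → j ≢ suc d ↑ʳ l → P (d ↑ʳ l) j ≡ + 0
  apex-row-off l j j≢ = trans (apex-row l j) (off (splitAt (suc d) j) refl)
    where
    off : ∀ z → splitAt (suc d) j ≡ z → multicone m (columns A) z (inj₂ l) ≡ + 0
    off (inj₁ _) _ = refl
    off (inj₂ i) eq = δ-off {i = l} {j = i} (λ { refl → j≢ (sym (splitAt⁻¹-↑ʳ eq)) })

  apex-row-on : ∀ l → P (d ↑ʳ l) (suc d ↑ʳ l) ≡ + 1
  apex-row-on l = trans (apex-row l (suc d ↑ʳ l))
    (trans (cong (λ z → multicone m (columns A) z (inj₂ l)) (splitAt-↑ʳ (suc d) m l)) (δ-diag l))

  base-entry : ∀ i j → P (i ↑ˡ m) (j ↑ˡ m) ≡ A i j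
  base-entry i j = trans (pyramid-multicone m A (i ↑ˡ m) (j ↑ˡ m))
    (cong₂ (multicone m (columns A)) (splitAt-↑ˡ (suc d) j m) (splitAt-↑ˡ d i m))

  μ-apex : ∀ l → μ (suc d ↑ʳ l) ≡ 0ℚ
  μ-apex l = begin
    μ (suc d ↑ʳ l)
      ≡⟨ ℚₚ.*-identityʳ _ ⟨
    μ (suc d ↑ʳ l) ℚ.* 1ℚ
      ≡⟨ cong (λ x → μ (suc d ↑ʳ l) ℚ.* ι x) (apex-row-on l) ⟨
    μ (suc d ↑ʳ l) ℚ.* ι (P (d ↑ʳ l) (suc d ↑ʳ l))
      ≡⟨ sumℚ-single {f = λ j → μ j ℚ.* ι (P (d ↑ʳ l) j)} (suc d ↑ʳ l)
           (λ j j≢ → trans (cong (λ x → μ j ℚ.* ι x) (apex-row-off l j j≢)) (ℚₚ.*-zeroʳ (μ j))) ⟨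
    sumℚ (λ j → μ j ℚ.* ι (P (d ↑ʳ l) j))
      ≡⟨ rows (d ↑ʳ l) ⟩
    0ℚ ∎

  μ-base : ∀ j → μ (j ↑ˡ m) ≡ 0ℚ
  μ-base = independent (λ j → μ (j ↑ˡ m))
    (trans (sym (sumℚ-↑ˡ (suc d) {f = μ} μ-apex)) total)
    λ i → begin
      sumℚ (λ j → μ (j ↑ˡ m) ℚ.* ι (A i j))
        ≡⟨ sumℚ-cong (λ j → cong (λ x → μ (j ↑ˡ m) ℚ.* ι x) (base-entry i j)) ⟨
      sumℚ (λ j → μ (j ↑ˡ m) ℚ.* ι (P (i ↑ˡ m) (j ↑ˡ m)))
        ≡⟨ sumℚ-↑ˡ (suc d) {f = λ j → μ j ℚ.* ι (P (i ↑ˡ m) j)}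
             (λ l → trans (cong (ℚ._* ι (P (i ↑ˡ m) (suc d ↑ʳ l))) (μ-apex l)) (ℚₚ.*-zeroˡ (ι (P (i ↑ˡ m) (suc d ↑ʳ l))))) ⟨
      sumℚ (λ j → μ j ℚ.* ι (P (i ↑ˡ m) j))
        ≡⟨ rows (i ↑ˡ m) ⟩
      0ℚ ∎

  by-cases : ∀ z → splitAt (suc d) j ≡ z → μ j ≡ 0ℚ
  by-cases (inj₁ i) eq = trans (cong μ (sym (splitAt⁻¹-↑ˡ eq))) (μ-base i)
  by-cases (inj₂ l) eq = trans (cong μ (sym (splitAt⁻¹-↑ʳ eq))) (μ-apex l)

simplex-⇔ : ∀ {d} {V W : IntMat d (suc d)} → FullDimSimplex V → FullDimSimplex W →
  UnimodEquiv V W ⇔ LatticeEquiv (columns V) (columns W)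
simplex-⇔ V-independent W-independent = mk⇔ (unimodular⇒lattice W-independent) (lattice⇒unimodular V-independent)

theorem2p10 : (d m : ℕ) → 1 ≤ m →
    (A B : IntMat d (suc d)) →
    FullDimSimplex A → FullDimSimplex B →
    UnimodEquiv A B ⇔ UnimodEquiv (pyramid m A) (pyramid m B)
theorem2p10 d m _ A B A-independent B-independent = mk⇔
  (Equivalence.from pyramids ∘ Equivalence.to (pyramid-⇔ m A B) ∘ Equivalence.to bases)
  (Equivalence.from bases ∘ Equivalence.from (pyramid-⇔ m A B) ∘ Equivalence.to pyramids)
  where
  bases : UnimodEquiv A B ⇔ LatticeEquiv (columns A) (columns B)
  bases = simplex-⇔ A-independent B-independent
  pyramids : UnimodEquiv (pyramid m A) (pyramid m B) ⇔ LatticeEquiv (columns (pyramid m A)) (columns (pyramid m B))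
  pyramids = simplex-⇔ (pyramid-independent m A-independent) (pyramid-independent m B-independent)
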